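{- Let $t\ge -1$ be an integer, let $\theta$ be a root of $P_t(x)=x^3-tx^2-(t+3)x-1$ and $K=\mathbb{Q}(\theta)$ (a simplest cubic field). Suppose that $\mathcal{O}_K=\mathbb{Z}[\theta]$. Then $K$ is unit reducible.
   Context: For a totally real number field $K$ with ring of integers $\mathcal{O}_K$ and unit group $\mathcal{O}_K^\times$, let $K_{>>0}$ be the set of totally positive elements and, for $a\in K_{>>0}$, $\mu(a)=\min_{x\in\mathcal{O}_K\setminus\{0\}}\mathrm{Tr}_{K/\mathbb{Q}}(ax^2)$. $K$ is called unit reducible if $\mu(a)=\min_{u\in\mathcal{O}_K^\times}\mathrm{Tr}_{K/\mathbb{Q}}(au^2)$ for all $a\in K_{>>0}$. -}

module Defs where

open import Algebra.Apartness.Bundles using (HeytingField; HeytingCommutativeRing)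
open import Algebra.Bundles using (CommutativeRing)
open import Algebra.Bundles.Raw using (RawRing)
import Algebra.Definitions.RawMonoid as RawMonoidDefs
open import Algebra.Morphism.Structures using (IsRingHomomorphism)
open import Data.Integer.Base as ℤ using (ℤ; +_; 1ℤ; -1ℤ)
open import Data.List.Base using (List; []; _∷_; map; _∷ʳ_)
open import Data.Nat.Base as ℕ using (ℕ)
import Data.Nat.Properties as ℕₚ
open import Data.Product.Base using (∃-syntax; _×_; _,_)
open import Data.Rational.Base as ℚ using (ℚ; 0ℚ; 1ℚ; ½; ∣_∣; 1/_)
import Data.Rational.Properties as ℚₚ
open import Data.Rational.Solver using (module +-*-Solver)
open import Data.Vec.Functional using (Vector)
open import Level using (0ℓ; _⊔_) renaming (suc to lsuc)
open import Relation.Binary.PropositionalEquality using (_≡_; refl; sym; trans; cong; subst)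
open import Relation.Nullary.Negation using (¬_)

------------------------------------------------------------------------
-- Real numbers: Cauchy sequences of rationals with termwise operations,
-- equal when their difference tends to 0.

module Reals where

  open import Data.Rational.Base using (_+_; _*_; _-_; -_; _<_; _≤_; Positive)

  Eventually : (ℕ → Set) → Set
  Eventually P = ∃[ N ] (∀ n → N ℕ.≤ n → P n)

  Cauchy : (ℕ → ℚ) → Set
  Cauchy x = ∀ ε → 0ℚ < ε →
    ∃[ N ] (∀ m n → N ℕ.≤ m → N ℕ.≤ n → ∣ x m - x n ∣ < ε)

  record ℝ : Set where
    constructor mkℝ
    field
      seq    : ℕ → ℚ
      cauchy : Cauchy seq

  open ℝ public

  infix 4 _≈ᵣ_ _<ᵣ_

  _≈ᵣ_ : ℝ → ℝ → Set
  x ≈ᵣ y = ∀ ε → 0ℚ < ε → Eventually (λ n → ∣ seq x n - seq y n ∣ < ε)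

  -- The gap must be bounded below by one positive rational: termwise
  -- inequality alone would allow both sequences to have the same limit.
  _<ᵣ_ : ℝ → ℝ → Set
  x <ᵣ y = ∃[ ε ] (0ℚ < ε × Eventually (λ n → ε < seq y n - seq x n))

  private
    open +-*-Solver using (solve; _:+_; _:*_; _:-_; :-_; _:=_)

    0<½ : 0ℚ < ½
    0<½ = ℚₚ.positive⁻¹ ½

    *-pos : ∀ {p q} → 0ℚ < p → 0ℚ < q → 0ℚ < p * q
    *-pos {p} {q} 0<p 0<q = ℚₚ.positive⁻¹ (p * q)
      {{ℚₚ.pos*pos⇒pos p {{ℚ.positive 0<p}} q {{ℚ.positive 0<q}}}}

    half+half : ∀ ε → ε * ½ + ε * ½ ≡ ε
    half+half ε = trans (sym (ℚₚ.*-distribˡ-+ ε ½ ½)) (ℚₚ.*-identityʳ ε)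

    constant-cauchy : ∀ q → Cauchy (λ _ → q)
    constant-cauchy q ε 0<ε =
      0 , λ _ _ _ _ → subst (λ z → ∣ z ∣ < ε) (sym (ℚₚ.+-inverseʳ q)) 0<ε

    neg-cauchy : ∀ {x} → Cauchy x → Cauchy (λ n → - x n)
    neg-cauchy {x} cx ε 0<ε = let (N , h) = cx ε 0<ε in N , λ m n N≤m N≤n →
      subst (_< ε)
        (trans (sym (ℚₚ.∣-p∣≡∣p∣ (x m - x n)))
               (cong ∣_∣ (solve 2 (λ a b → :- (a :- b) := (:- a) :- (:- b)) refl (x m) (x n))))
        (h m n N≤m N≤n)

    +-cauchy : ∀ {x y} → Cauchy x → Cauchy y → Cauchy (λ n → x n + y n)
    +-cauchy {x} {y} cx cy ε 0<ε =
      let (N , h) = cx (ε * ½) (*-pos 0<ε 0<½)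
          (M , k) = cy (ε * ½) (*-pos 0<ε 0<½)
      in N ℕ.⊔ M , λ m n p q →
      begin-strict
        ∣ (x m + y m) - (x n + y n) ∣
          ≡⟨ cong ∣_∣ (solve 4 (λ a b c d → (a :+ b) :- (c :+ d) := (a :- c) :+ (b :- d))
                         refl (x m) (y m) (x n) (y n)) ⟩
        ∣ (x m - x n) + (y m - y n) ∣
          ≤⟨ ℚₚ.∣p+q∣≤∣p∣+∣q∣ (x m - x n) (y m - y n) ⟩
        ∣ x m - x n ∣ + ∣ y m - y n ∣
          <⟨ ℚₚ.+-mono-<
               (h m n (ℕₚ.m⊔n≤o⇒m≤o N M p) (ℕₚ.m⊔n≤o⇒m≤o N M q))
               (k m n (ℕₚ.m⊔n≤o⇒n≤o N M p) (ℕₚ.m⊔n≤o⇒n≤o N M q)) ⟩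
        ε * ½ + ε * ½
          ≡⟨ half+half ε ⟩
        ε ∎
      where open ℚₚ.≤-Reasoning

    bounded : ∀ {x} → Cauchy x →
      ∃[ B ] (0ℚ < B × Eventually (λ n → ∣ x n ∣ ≤ B))
    bounded {x} cx =
      let (N , h) = cx 1ℚ (ℚₚ.positive⁻¹ 1ℚ)
      in 1ℚ + ∣ x N ∣
       , ℚₚ.+-mono-<-≤ (ℚₚ.positive⁻¹ 1ℚ) (ℚₚ.0≤∣p∣ (x N))
       , N , λ n N≤n → begin
        ∣ x n ∣
          ≡⟨ cong ∣_∣ (solve 2 (λ a b → a := (a :- b) :+ b) refl (x n) (x N)) ⟩
        ∣ (x n - x N) + x N ∣
          ≤⟨ ℚₚ.∣p+q∣≤∣p∣+∣q∣ (x n - x N) (x N) ⟩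
        ∣ x n - x N ∣ + ∣ x N ∣
          ≤⟨ ℚₚ.+-monoˡ-≤ ∣ x N ∣ (ℚₚ.<⇒≤ (h n N N≤n ℕₚ.≤-refl)) ⟩
        1ℚ + ∣ x N ∣ ∎
      where open ℚₚ.≤-Reasoning

    -- If |p| ≤ B and |q| < ε / (2B) then |p q| < ε / 2.
    scaled : ∀ {B} → 0ℚ < B → ∀ ε → 0ℚ < ε →
      ∃[ δ ] (0ℚ < δ × (∀ p q → ∣ p ∣ ≤ B → ∣ q ∣ < δ → ∣ p * q ∣ < ε * ½))
    scaled {B} 0<B ε 0<ε = δ , 0<δ , λ p q p≤B q<δ →
      begin-strict
        ∣ p * q ∣        ≡⟨ ℚₚ.∣p*q∣≡∣p∣*∣q∣ p q ⟩
        ∣ p ∣ * ∣ q ∣    ≤⟨ ℚₚ.*-monoʳ-≤-nonNeg ∣ q ∣ {{ℚₚ.∣-∣-nonNeg q}} p≤B ⟩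
        B * ∣ q ∣        <⟨ ℚₚ.*-monoʳ-<-pos B q<δ ⟩
        B * δ            ≡⟨ solve 3 (λ a b c → a :* (b :* c) := b :* (a :* c)) refl B (ε * ½) (1/ B) ⟩
        ε * ½ * (B * 1/ B) ≡⟨ cong (ε * ½ *_) (ℚₚ.*-inverseʳ B) ⟩
        ε * ½ * 1ℚ       ≡⟨ ℚₚ.*-identityʳ (ε * ½) ⟩
        ε * ½            ∎
      where
      open ℚₚ.≤-Reasoning
      instance
        B-pos : Positive B
        B-pos = ℚ.positive 0<B
        B-nz : ℚ.NonZero B
        B-nz = ℚₚ.pos⇒nonZero B
      δ : ℚ
      δ = ε * ½ * 1/ B
      0<δ : 0ℚ < δ
      0<δ = *-pos (*-pos 0<ε 0<½) (ℚₚ.positive⁻¹ (1/ B) {{ℚₚ.1/pos⇒pos B}})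

    *-cauchy : ∀ {x y} → Cauchy x → Cauchy y → Cauchy (λ n → x n * y n)
    *-cauchy {x} {y} cx cy ε 0<ε =
      let (B , 0<B , K , bx) = bounded cx
          (C , 0<C , L , by) = bounded cy
          (δ , 0<δ , sx)     = scaled 0<B ε 0<ε
          (η , 0<η , sy)     = scaled 0<C ε 0<ε
          (N , h)            = cy δ 0<δ
          (M , k)            = cx η 0<η
      in (K ℕ.⊔ L) ℕ.⊔ (N ℕ.⊔ M) , λ m n p q →
      let kl : ∀ {o} → (K ℕ.⊔ L) ℕ.⊔ (N ℕ.⊔ M) ℕ.≤ o → K ℕ.⊔ L ℕ.≤ o
          kl = ℕₚ.m⊔n≤o⇒m≤o (K ℕ.⊔ L) (N ℕ.⊔ M)
          nm : ∀ {o} → (K ℕ.⊔ L) ℕ.⊔ (N ℕ.⊔ M) ℕ.≤ o → N ℕ.⊔ M ℕ.≤ o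
          nm = ℕₚ.m⊔n≤o⇒n≤o (K ℕ.⊔ L) (N ℕ.⊔ M)
      in begin-strict
        ∣ x m * y m - x n * y n ∣
          ≡⟨ cong ∣_∣ (solve 4 (λ a b c d → a :* b :- c :* d := a :* (b :- d) :+ d :* (a :- c))
                         refl (x m) (y m) (x n) (y n)) ⟩
        ∣ x m * (y m - y n) + y n * (x m - x n) ∣
          ≤⟨ ℚₚ.∣p+q∣≤∣p∣+∣q∣ (x m * (y m - y n)) (y n * (x m - x n)) ⟩
        ∣ x m * (y m - y n) ∣ + ∣ y n * (x m - x n) ∣
          <⟨ ℚₚ.+-mono-<
               (sx (x m) (y m - y n) (bx m (ℕₚ.m⊔n≤o⇒m≤o K L (kl p)))
                 (h m n (ℕₚ.m⊔n≤o⇒m≤o N M (nm p)) (ℕₚ.m⊔n≤o⇒m≤o N M (nm q))))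
               (sy (y n) (x m - x n) (by n (ℕₚ.m⊔n≤o⇒n≤o K L (kl q)))
                 (k m n (ℕₚ.m⊔n≤o⇒n≤o N M (nm p)) (ℕₚ.m⊔n≤o⇒n≤o N M (nm q)))) ⟩
        ε * ½ + ε * ½
          ≡⟨ half+half ε ⟩
        ε ∎
      where open ℚₚ.≤-Reasoning

  fromℚ : ℚ → ℝ
  fromℚ q = mkℝ (λ _ → q) (constant-cauchy q)

  infixl 6 _+ᵣ_
  infixl 7 _*ᵣ_

  _+ᵣ_ : ℝ → ℝ → ℝ
  x +ᵣ y = mkℝ (λ n → seq x n + seq y n) (+-cauchy {seq x} {seq y} (cauchy x) (cauchy y))

  _*ᵣ_ : ℝ → ℝ → ℝ
  x *ᵣ y = mkℝ (λ n → seq x n * seq y n) (*-cauchy {seq x} {seq y} (cauchy x) (cauchy y))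

  -ᵣ_ : ℝ → ℝ
  -ᵣ x = mkℝ (λ n → - seq x n) (neg-cauchy {seq x} (cauchy x))

  ℝ-rawRing : RawRing 0ℓ 0ℓ
  ℝ-rawRing = record
    { Carrier = ℝ
    ; _≈_     = _≈ᵣ_
    ; _+_     = _+ᵣ_
    ; _*_     = _*ᵣ_
    ; -_      = -ᵣ_
    ; 0#      = fromℚ 0ℚ
    ; 1#      = fromℚ 1ℚ
    }

open Reals public using (ℝ; mkℝ; seq; cauchy; fromℚ; _≈ᵣ_; _<ᵣ_; _+ᵣ_; _*ᵣ_; -ᵣ_; ℝ-rawRing)

------------------------------------------------------------------------
-- Number fields

-- A field K with a homomorphism ι : ℚ → K and a finite ℚ-basis; coord gives
-- the (unique) coordinates of an element in that basis.
record NumberField c ℓ₁ ℓ₂ : Set (lsuc (c ⊔ ℓ₁ ⊔ ℓ₂)) where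
  field
    heytingField : HeytingField c ℓ₁ ℓ₂

  open HeytingField heytingField public using (_#_; heytingCommutativeRing)
  open HeytingCommutativeRing heytingCommutativeRing public using (commutativeRing)
  open CommutativeRing commutativeRing public
  open RawMonoidDefs +-rawMonoid public using (sum)

  field
    ι                    : ℚ → Carrier
    ι-isRingHomomorphism : IsRingHomomorphism ℚ.+-*-rawRing rawRing ι
    degree               : ℕ
    basis                : Vector Carrier degree
    coord                : Carrier → Vector ℚ degree
    coord-expansion      : ∀ x → x ≈ sum (λ i → ι (coord x i) * basis i)
    coord-unique         : ∀ x (q : Vector ℚ degree) →
                           x ≈ sum (λ i → ι (q i) * basis i) → ∀ i → q i ≡ coord x i

IsMinimum : ∀ {a p} {A : Set a} → (A → Set p) → (A → ℚ) → ℚ → Set (a ⊔ p)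
IsMinimum S f m = (∃[ x ] (S x × f x ≡ m)) × (∀ x → S x → m ℚ.≤ f x)

module _ {c ℓ₁ ℓ₂} (K : NumberField c ℓ₁ ℓ₂) where

  open NumberField K

  -- Trace of the ℚ-linear map "multiplication by x".
  Tr : Carrier → ℚ
  Tr x = RawMonoidDefs.sum ℚ.+-0-rawMonoid (λ i → coord (x * basis i) i)

  -- Coefficient lists start with the constant term.
  eval : List ℚ → Carrier → Carrier
  eval []       x = 0#
  eval (q ∷ qs) x = ι q + x * eval qs x

  evalℤ : List ℤ → Carrier → Carrier
  evalℤ p = eval (map (ℚ._/ 1) p)

  -- 𝒪 x means x ∈ 𝒪_K: x is a root of a monic integer polynomial.
  𝒪 : Carrier → Set ℓ₁
  𝒪 x = ∃[ p ] evalℤ (p ∷ʳ 1ℤ) x ≈ 0#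

  𝒪-nonzero : Carrier → Set ℓ₁
  𝒪-nonzero x = 𝒪 x × ¬ (x ≈ 0#)

  𝒪-unit : Carrier → Set (c ⊔ ℓ₁)
  𝒪-unit u = 𝒪 u × (∃[ v ] (𝒪 v × u * v ≈ 1#))

  ℤ[_] : Carrier → Carrier → Set ℓ₁
  ℤ[ θ ] x = ∃[ p ] x ≈ evalℤ p θ

  -- ℚ(θ), the field of fractions f(θ) / g(θ).
  ℚ⟨_⟩ : Carrier → Carrier → Set (ℓ₁ ⊔ ℓ₂)
  ℚ⟨ θ ⟩ x = ∃[ f ] ∃[ g ] (eval g θ # 0# × x * eval g θ ≈ eval f θ)

  TotallyPositive : Carrier → Set (c ⊔ ℓ₁)
  TotallyPositive a = (σ : Carrier → ℝ) → IsRingHomomorphism rawRing ℝ-rawRing σ →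
                      fromℚ 0ℚ <ᵣ σ a

  -- Only meaningful for totally real K; the existence of both minima is part of
  -- the condition.
  UnitReducible : Set (c ⊔ ℓ₁)
  UnitReducible = ∀ a → TotallyPositive a →
    ∃[ μ ] ( IsMinimum 𝒪-nonzero (λ x → Tr (a * (x * x))) μ
           × IsMinimum 𝒪-unit    (λ u → Tr (a * (u * u))) μ )

simplestCubic : ℤ → List ℤ
simplestCubic t = -1ℤ ∷ ℤ.- (t ℤ.+ + 3) ∷ ℤ.- t ∷ 1ℤ ∷ []

{-# OPTIONS --safe #-}
-- Write ℤ[θ] = ℤ³ and fix a ≫ 0.  Up to units, the unit squares span two kinds
-- of triangles, T₁ = {1, θ², (θ+1)²} and T₂ = {θ², (θ+1)², θ²(θ+1)²}.  The linear
-- functional equal to 1 on T₂ is integral, the one equal to 1 on T₁ is half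
-- integral, and both are positive definite at squares: for x = a + bθ + cθ² they
-- take the values a² + c² + (a-b+c)² and half of
-- (a-b+c)² + (a+c)² + (b+tc)² + (t+3)c² at x².  Hence both are at least 1 at every
-- nonzero square, and x² - 1 lies in the cone spanned by the w² - 1 for the six
-- units w sharing a triangle with 1.  So if Tr(a) ≤ Tr(aw²) for these w then
-- Tr(a) ≤ Tr(ax²) for all nonzero x; otherwise replace a by aw² for a w violating
-- the inequality.  This descent stops since Tr(aℤ[θ]) has bounded denominators
-- and Tr(au²) ≥ 0, the sum over the three real embeddings of σ(a)σ(u)².
module Submission where

open import Defs
open import Data.Product.Base using (_×_; _,_; proj₁)
open import Data.Fin.Base using (Fin)
open import Data.Fin.Patterns
open import Relation.Binary.PropositionalEquality.Core using (_≡_)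

-- Six rays in dimension three do not span a simplicial cone, so a point of it has no canonical
-- coefficients. Three diagonals cut it into four simplicial cones; in each of them Cramer's rule
-- gives the coefficients as explicit polynomials, and membership becomes one polynomial identity
-- together with signs.
--
-- Little is given about `K`: its equality need not be decidable, its basis is arbitrary and no
-- embedding into the reals comes with it. Coordinates with respect to `1, θ, θ²` are unique because
-- the norm form of the order has no nontrivial zero, which is read off modulo 2. Total positivity
-- speaks only about homomorphisms that one can exhibit, so three are built: one root of the cubic
-- by bisection, the other two as polynomials in it. This is possible because the extension is
-- Galois, with group generated by `θ ↦ -(1 + θ)/θ`. The same map rotates the hexagon around 1: it
-- sends `(w k)²` to `(w (k+2))²`.

record Unit {a} {A : Set a} (_·_ : A → A → A) (1# u : A) : Set a where
  constructor unit
  field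
    inverse  : A
    inverseʳ : u · inverse ≡ 1#

-- The cubic order in coordinates, and the hexagon of unit squares around 1

module CubicOrder {a} {A : Set a} (_+_ _*_ : A → A → A) (-_ : A → A) (0# 1# t : A) where

  private
    infixl 6 _⊕_ _⊖_
    infixl 7 _⊗_
    _⊕_ _⊗_ _⊖_ : A → A → A
    _⊕_ = _+_
    _⊗_ = _*_
    x ⊖ y = x ⊕ (- y)

  Triple : Set a
  Triple = A × A × A

  2# 3# e : A
  2# = 1# ⊕ 1#
  3# = 1# ⊕ 2#
  e  = t ⊕ 3#

  -- θ³ = 1 + eθ + tθ² and θ⁴ = t + (te + 1)θ + (t² + e)θ².
  infixl 7 _·_
  _·_ : Triple → Triple → Triple
  (a₀ , a₁ , a₂) · (b₀ , b₁ , b₂) =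
      a₀ ⊗ b₀ ⊕ d₃ ⊕ t ⊗ d₄
    , a₀ ⊗ b₁ ⊕ a₁ ⊗ b₀ ⊕ e ⊗ d₃ ⊕ (t ⊗ e ⊕ 1#) ⊗ d₄
    , a₀ ⊗ b₂ ⊕ a₁ ⊗ b₁ ⊕ a₂ ⊗ b₀ ⊕ t ⊗ d₃ ⊕ (t ⊗ t ⊕ e) ⊗ d₄
    where
    d₃ = a₁ ⊗ b₂ ⊕ a₂ ⊗ b₁
    d₄ = a₂ ⊗ b₂

  shift : Triple → Triple
  shift (a , b , c) = c , a ⊕ e ⊗ c , b ⊕ t ⊗ c

  -- The adjugate of the matrix of multiplication by x, applied to 1.
  adj : Triple → Triple
  adj x@(_ , x₁ , x₂) with shift x
  ... | y@(_ , y₁ , y₂) with shift y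
  ... | _ , z₁ , z₂ = y₁ ⊗ z₂ ⊖ z₁ ⊗ y₂ , z₁ ⊗ x₂ ⊖ x₁ ⊗ z₂ , x₁ ⊗ y₂ ⊖ y₁ ⊗ x₂

  norm : Triple → A
  norm x = proj₁ (x · adj x)

  sq : Triple → Triple
  sq x = x · x

  zero one θ θ² θ+1 θ⁻¹ θ+1⁻¹ : Triple
  zero  = 0# , 0# , 0#
  one   = 1# , 0# , 0#
  θ     = 0# , 1# , 0#
  θ²    = 0# , 0# , 1#
  θ+1   = 1# , 1# , 0#
  θ⁻¹   = - e , - t , 1#
  θ+1⁻¹ = 2# , 1# ⊕ t , - 1#

  IsUnit : Triple → Set a
  IsUnit = Unit _·_ one

  -- The unit squares adjacent to 1 on the boundary of the convex hull of all
  -- unit squares are those of w 0, …, w 5, in cyclic order.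
  w : Fin 6 → Triple
  w 0F = θ
  w 1F = θ+1
  w 2F = θ+1 · θ⁻¹
  w 3F = θ⁻¹
  w 4F = θ+1⁻¹
  w 5F = θ · θ+1⁻¹

  ⟨_∣_⟩ : Triple → Triple → A
  ⟨ f₀ , f₁ , f₂ ∣ y₀ , y₁ , y₂ ⟩ = f₀ ⊗ y₀ ⊕ f₁ ⊗ y₁ ⊕ f₂ ⊗ y₂

  -- The traces of 1, θ and θ².
  traces : Triple
  traces = 3# , t , t ⊗ t ⊕ 2# ⊗ e

  -- Multiplication by `s` is linear, so this is again a functional. With `traces` for `f` and the
  -- coordinates of `a` for `s` it is `y ↦ Tr(a y)`; with a unit square for `s` it replaces `a` by
  -- `a w²` in the descent.
  pull : Triple → Triple → Triple
  pull f s = ⟨ f ∣ s · one ⟩ , ⟨ f ∣ s · θ ⟩ , ⟨ f ∣ s · θ² ⟩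

  gap : Triple → Triple → A
  gap f y = ⟨ f ∣ y ⟩ ⊖ ⟨ f ∣ one ⟩

  -- L₁ takes the value 2 at 1, θ², (θ+1)², and L₂ takes the value 1 at
  -- θ², (θ+1)², θ²(θ+1)².
  L₁ L₂ : Triple
  L₁ = 2# , - 1# , 2#
  L₂ = 2# , - 1# , 1#

  q₁ q₂ : Triple → A
  q₁ x = ⟨ L₁ ∣ sq x ⟩
  q₂ x = ⟨ L₂ ∣ sq x ⟩

  -- facet k is constant on the face with vertices 1, (w k)² and (w (k+1))².
  facet : Fin 6 → Triple → A
  facet 0F y = ⟨ L₁ ∣ y ⟩
  facet 1F y = ⟨ L₂ ∣ sq θ · y ⟩
  facet 2F y = ⟨ L₁ ∣ sq θ · y ⟩
  facet 3F y = ⟨ L₂ ∣ sq (θ · θ+1) · y ⟩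
  facet 4F y = ⟨ L₁ ∣ sq θ+1 · y ⟩
  facet 5F y = ⟨ L₂ ∣ sq θ+1 · y ⟩

  -- diagonal k is 0 at 1, (w 2k)² and (w (2k+2))², and positive at (w (2k+1))².
  d : A
  d = t ⊗ t ⊕ t ⊕ 1#

  diagonal : Fin 3 → Triple → A
  diagonal 0F y = gap (- d , t ⊗ t ⊕ 2# ⊗ t ⊕ 2# , - d) y
  diagonal 1F y = gap (- d , - (t ⊗ t ⊗ t ⊕ 2# ⊗ t ⊗ t ⊕ 3# ⊗ t ⊕ 1#) ,
    - (d ⊗ (t ⊗ t ⊕ 2# ⊗ t ⊕ (1# ⊕ 3#)))) y
  diagonal 2F y = gap (- d , - 1# , - d) y

  -- Normalising constants of the four cones. `D` is the value of `diagonal k` at `(w (2k+1))²` and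
  -- the excess of `facet (2k)` over 2 at `(w (2k+2))²`; `- E` is the value of `diagonal k` at the
  -- even vertex `(w (2k+4))²` on its other side.
  D E : A
  D = t ⊗ t ⊕ 3# ⊗ t ⊕ 3#
  E = d ⊗ (t ⊗ t ⊕ 2# ⊗ t ⊕ 3#)

-- Used for ring homomorphisms as well as for reduction modulo 2.
module CubicRelation
  {a b r} {A : Set a} {B : Set b} (R : A → B → Set r)
  {_+_ _*_ : A → A → A} { -_ : A → A} {0# 1# t : A}
  {_+′_ _*′_ : B → B → B} { -′_ : B → B} {0#′ 1#′ t′ : B}
  (R-+ : ∀ {x x′ y y′} → R x x′ → R y y′ → R (x + y) (x′ +′ y′))
  (R-* : ∀ {x x′ y y′} → R x x′ → R y y′ → R (x * y) (x′ *′ y′))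
  (R-neg : ∀ {x x′} → R x x′ → R (- x) (-′ x′))
  (R-0 : R 0# 0#′) (R-1 : R 1# 1#′) (R-t : R t t′)
  where

  private
    module C = CubicOrder _+_ _*_ -_ 0# 1# t
    module C′ = CubicOrder _+′_ _*′_ -′_ 0#′ 1#′ t′
    infixl 6 _⊕_ _⊖_
    infixl 7 _⊗_
    _⊕_ : ∀ {x x′ y y′} → R x x′ → R y y′ → R (x + y) (x′ +′ y′)
    _⊕_ = R-+
    _⊗_ : ∀ {x x′ y y′} → R x x′ → R y y′ → R (x * y) (x′ *′ y′)
    _⊗_ = R-*
    _⊖_ : ∀ {x x′ y y′} → R x x′ → R y y′ → R (x + (- y)) (x′ +′ (-′ y′))
    p ⊖ q = R-+ p (R-neg q)

  R³ : C.Triple → C′.Triple → Set r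
  R³ (a , b , c) (a′ , b′ , c′) = R a a′ × R b b′ × R c c′

  R-e : R C.e C′.e
  R-e = R-t ⊕ (R-1 ⊕ (R-1 ⊕ R-1))

  R-· : ∀ {x x′ y y′} → R³ x x′ → R³ y y′ → R³ (x C.· y) (x′ C′.· y′)
  R-· (a₀ , a₁ , a₂) (b₀ , b₁ , b₂) =
      a₀ ⊗ b₀ ⊕ d₃ ⊕ R-t ⊗ d₄
    , a₀ ⊗ b₁ ⊕ a₁ ⊗ b₀ ⊕ R-e ⊗ d₃ ⊕ (R-t ⊗ R-e ⊕ R-1) ⊗ d₄
    , a₀ ⊗ b₂ ⊕ a₁ ⊗ b₁ ⊕ a₂ ⊗ b₀ ⊕ R-t ⊗ d₃ ⊕ (R-t ⊗ R-t ⊕ R-e) ⊗ d₄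
    where
    d₃ = a₁ ⊗ b₂ ⊕ a₂ ⊗ b₁
    d₄ = a₂ ⊗ b₂

  R-shift : ∀ {x x′} → R³ x x′ → R³ (C.shift x) (C′.shift x′)
  R-shift (a , b , c) = c , a ⊕ R-e ⊗ c , b ⊕ R-t ⊗ c

  R-adj : ∀ {x x′} → R³ x x′ → R³ (C.adj x) (C′.adj x′)
  R-adj x@(_ , x₁ , x₂) with R-shift x
  ... | y@(_ , y₁ , y₂) with R-shift y
  ... | _ , z₁ , z₂ = y₁ ⊗ z₂ ⊖ z₁ ⊗ y₂ , z₁ ⊗ x₂ ⊖ x₁ ⊗ z₂ , x₁ ⊗ y₂ ⊖ y₁ ⊗ x₂

  R-norm : ∀ {x x′} → R³ x x′ → R (C.norm x) (C′.norm x′)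
  R-norm x = proj₁ (R-· x (R-adj x))

  R-⟨∣⟩ : ∀ {f f′ y y′} → R³ f f′ → R³ y y′ → R C.⟨ f ∣ y ⟩ C′.⟨ f′ ∣ y′ ⟩
  R-⟨∣⟩ (f₀ , f₁ , f₂) (y₀ , y₁ , y₂) = f₀ ⊗ y₀ ⊕ f₁ ⊗ y₁ ⊕ f₂ ⊗ y₂

-- Polynomial identities in the order

module Identities where

  open import Data.Product.Base using (_×_; _,_; proj₁; proj₂)
  open import Data.Integer.Base
  open import Data.Integer.Solver
  open import Relation.Binary.PropositionalEquality
  open import Data.Vec.Base using (Vec; _∷_; [])
  open import Data.Fin.Patterns
  import Data.Nat.Base as ℕ
  open +-*-Solver

  module Z (t : ℤ) = CubicOrder _+_ _*_ -_ 0ℤ 1ℤ t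
  -- The formulas of the order read in the syntax of the ring solver, with `t` as variable 0. Both
  -- sides of an identity are thus obtained by running the definitions, and no expanded polynomial
  -- has to be written down.
  module P {n} = CubicOrder {A = Polynomial (ℕ.suc n)} _:+_ _:*_ :-_ (con 0ℤ) (con 1ℤ) (var 0F)

  triple : ∀ {a} {A : Set a} {x y z x' y' z' : A} → x ≡ x' → y ≡ y' → z ≡ z' → (x , y , z) ≡
    (x' , y' , z')
  triple refl refl refl = refl

  P³ : ℕ.ℕ → Set
  P³ n = Polynomial n × Polynomial n × Polynomial n

  ⟦_⟧³ : ∀ {n} → P³ n → Vec ℤ n → ℤ × ℤ × ℤ
  ⟦ p , q , r ⟧³ ρ = ⟦ p ⟧ ρ , ⟦ q ⟧ ρ , ⟦ r ⟧ ρ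

  prove³ : ∀ {n} (ρ : Vec ℤ n) (l r : P³ n) →
    ⟦ proj₁ l ⟧↓ ρ ≡ ⟦ proj₁ r ⟧↓ ρ →
    ⟦ proj₁ (proj₂ l) ⟧↓ ρ ≡ ⟦ proj₁ (proj₂ r) ⟧↓ ρ →
    ⟦ proj₂ (proj₂ l) ⟧↓ ρ ≡ ⟦ proj₂ (proj₂ r) ⟧↓ ρ →
    ⟦ l ⟧³ ρ ≡ ⟦ r ⟧³ ρ
  prove³ ρ (l₀ , l₁ , l₂) (r₀ , r₁ , r₂) e₀ e₁ e₂ =
    triple (prove ρ l₀ r₀ e₀) (prove ρ l₁ r₁ e₁) (prove ρ l₂ r₂ e₂)

  X Y F : ∀ {n} → P³ (7 ℕ.+ n)
  X = var 1F , var 2F , var 3F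
  Y = var 4F , var 5F , var 6F
  F = X

  module _ (t : ℤ) where
    open Z t
    ·-comm : ∀ x y → x · y ≡ y · x
    ·-comm (x₀ , x₁ , x₂) (y₀ , y₁ , y₂) =
      prove³ (t ∷ x₀ ∷ x₁ ∷ x₂ ∷ y₀ ∷ y₁ ∷ y₂ ∷ []) (X P.· Y) (Y P.· X) refl refl refl

    ·-assoc : ∀ x y z → (x · y) · z ≡ x · (y · z)
    ·-assoc (x₀ , x₁ , x₂) (y₀ , y₁ , y₂) (z₀ , z₁ , z₂) =
      prove³ (t ∷ x₀ ∷ x₁ ∷ x₂ ∷ y₀ ∷ y₁ ∷ y₂ ∷ z₀ ∷ z₁ ∷ z₂ ∷ [])
        ((X P.· Y) P.· Z) (X P.· (Y P.· Z)) refl refl refl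
      where Z = var 7F , var 8F , var 9F

    ·-identityˡ : ∀ x → one · x ≡ x
    ·-identityˡ (x₀ , x₁ , x₂) =
      prove³ (t ∷ x₀ ∷ x₁ ∷ x₂ ∷ []) (P.one P.· x) x refl refl refl
      where x = var 1F , var 2F , var 3F

    pull-correct : ∀ f s y → ⟨ f ∣ s · y ⟩ ≡ ⟨ pull f s ∣ y ⟩
    pull-correct (f₀ , f₁ , f₂) (s₀ , s₁ , s₂) (y₀ , y₁ , y₂) =
      prove (t ∷ f₀ ∷ f₁ ∷ f₂ ∷ y₀ ∷ y₁ ∷ y₂ ∷ s₀ ∷ s₁ ∷ s₂ ∷ [])
        P.⟨ F ∣ S P.· Y ⟩ P.⟨ P.pull F S ∣ Y ⟩ refl
      where S = var 7F , var 8F , var 9F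

    w-unit : ∀ k → IsUnit (w k)
    w-unit 0F = unit (w 3F) (prove³ (t ∷ []) (P.w 0F P.· P.w 3F) P.one refl refl refl)
    w-unit 1F = unit (w 4F) (prove³ (t ∷ []) (P.w 1F P.· P.w 4F) P.one refl refl refl)
    w-unit 2F = unit (w 5F) (prove³ (t ∷ []) (P.w 2F P.· P.w 5F) P.one refl refl refl)
    w-unit 3F = unit (w 0F) (prove³ (t ∷ []) (P.w 3F P.· P.w 0F) P.one refl refl refl)
    w-unit 4F = unit (w 1F) (prove³ (t ∷ []) (P.w 4F P.· P.w 1F) P.one refl refl refl)
    w-unit 5F = unit (w 2F) (prove³ (t ∷ []) (P.w 5F P.· P.w 2F) P.one refl refl refl)

    -- The cone spanned by the (w k)² - 1 is cut by the three diagonals into the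
    -- corners at w 1, w 3, w 5 and the central cone on w 0, w 2, w 4.
    corner₀ : ∀ f y → D * gap f y ≡
      D * (facet 1F y - 1ℤ) * gap f (sq (w 0F)) + diagonal 0F y * gap f (sq (w 1F)) +
        (facet 0F y - 1ℤ - 1ℤ) * gap f (sq (w 2F))
    corner₀ (f₀ , f₁ , f₂) (y₀ , y₁ , y₂) =
      prove (t ∷ f₀ ∷ f₁ ∷ f₂ ∷ y₀ ∷ y₁ ∷ y₂ ∷ []) (P.D :* P.gap F Y)
        (P.D :* (P.facet 1F Y :- con 1ℤ) :* P.gap F (P.sq (P.w 0F))
          :+ P.diagonal 0F Y :* P.gap F (P.sq (P.w 1F))
          :+ (P.facet 0F Y :- con 1ℤ :- con 1ℤ) :* P.gap F (P.sq (P.w 2F))) refl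

    -- This and `corner₂` are the Galois conjugates of `corner₀`: the rotation by two steps carries
    -- facets to facets and diagonals to diagonals, which is why `D` stays the same.
    corner₁ : ∀ f y → D * gap f y ≡
      D * (facet 3F y - 1ℤ) * gap f (sq (w 2F)) + diagonal 1F y * gap f (sq (w 3F)) +
        (facet 2F y - 1ℤ - 1ℤ) * gap f (sq (w 4F))
    corner₁ (f₀ , f₁ , f₂) (y₀ , y₁ , y₂) =
      prove (t ∷ f₀ ∷ f₁ ∷ f₂ ∷ y₀ ∷ y₁ ∷ y₂ ∷ []) (P.D :* P.gap F Y)
        (P.D :* (P.facet 3F Y :- con 1ℤ) :* P.gap F (P.sq (P.w 2F))
          :+ P.diagonal 1F Y :* P.gap F (P.sq (P.w 3F))
          :+ (P.facet 2F Y :- con 1ℤ :- con 1ℤ) :* P.gap F (P.sq (P.w 4F))) refl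

    corner₂ : ∀ f y → D * gap f y ≡
      D * (facet 5F y - 1ℤ) * gap f (sq (w 4F)) + diagonal 2F y * gap f (sq (w 5F)) +
        (facet 4F y - 1ℤ - 1ℤ) * gap f (sq (w 0F))
    corner₂ (f₀ , f₁ , f₂) (y₀ , y₁ , y₂) =
      prove (t ∷ f₀ ∷ f₁ ∷ f₂ ∷ y₀ ∷ y₁ ∷ y₂ ∷ []) (P.D :* P.gap F Y)
        (P.D :* (P.facet 5F Y :- con 1ℤ) :* P.gap F (P.sq (P.w 4F))
          :+ P.diagonal 2F Y :* P.gap F (P.sq (P.w 5F))
          :+ (P.facet 4F Y :- con 1ℤ :- con 1ℤ) :* P.gap F (P.sq (P.w 0F))) refl

    -- Interpolation, as for the corners: both sides are linear in `y - 1`, and they agree at the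
    -- three vertices because each coefficient vanishes at two of them and equals the constant on
    -- the left at the third.
    centre : ∀ f y → E * gap f y ≡
      - diagonal 1F y * gap f (sq (w 0F)) + - diagonal 2F y * gap f (sq (w 2F)) + - diagonal 0F y *
        gap f (sq (w 4F))
    centre (f₀ , f₁ , f₂) (y₀ , y₁ , y₂) =
      prove (t ∷ f₀ ∷ f₁ ∷ f₂ ∷ y₀ ∷ y₁ ∷ y₂ ∷ []) (P.E :* P.gap F Y)
        (:- P.diagonal 1F Y :* P.gap F (P.sq (P.w 0F))
          :+ :- P.diagonal 2F Y :* P.gap F (P.sq (P.w 2F))
          :+ :- P.diagonal 0F Y :* P.gap F (P.sq (P.w 4F))) refl

-- Descent to a unit of least value

module UnitDescent where

  open Identities
  open import Data.Product.Base using (_×_; _,_; proj₁; proj₂; ∃-syntax)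
  open import Data.Integer.Base
  open import Data.Integer.Solver
  import Data.Integer.Properties as ℤₚ
  open ℤₚ using (_≤?_; _≟_)
  open import Relation.Binary.PropositionalEquality
  open import Data.Vec.Base using (_∷_; [])
  open import Data.Fin.Base using (Fin)
  open import Data.Fin.Patterns
  open import Data.Fin.Properties using (all?; ¬∀⟶∃¬)
  import Data.Nat.Base as ℕ
  open import Relation.Nullary using (¬_; Dec; yes; no; contradiction)
  open import Data.Sum.Base using ([_,_]′)
  open import Function.Base using (id)
  open +-*-Solver

  0≤+ : ∀ {i j} → 0ℤ ≤ i → 0ℤ ≤ j → 0ℤ ≤ i + j
  0≤+ = ℤₚ.+-mono-≤

  0≤* : ∀ {i j} → 0ℤ ≤ i → 0ℤ ≤ j → 0ℤ ≤ i * j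
  0≤* {+ m} {+ n} _ _ = subst (0ℤ ≤_) (ℤₚ.pos-* m n) (+≤+ ℕ.z≤n)

  0≤i*i : ∀ i → 0ℤ ≤ i * i
  0≤i*i (+ n)    = 0≤* {+ n} {+ n} (+≤+ ℕ.z≤n) (+≤+ ℕ.z≤n)
  0≤i*i -[1+ n ] = +≤+ ℕ.z≤n

  i*i≤0⇒i≡0 : ∀ {i} → i * i ≤ 0ℤ → i ≡ 0ℤ
  i*i≤0⇒i≡0 {i} p = [ id , id ]′ (ℤₚ.i*j≡0⇒i≡0∨j≡0 i (ℤₚ.≤-antisym p (0≤i*i i)))

  i≢0⇒1≤i*i : ∀ {i} → i ≢ 0ℤ → 1ℤ ≤ i * i
  i≢0⇒1≤i*i {i} i≢0 with 1ℤ ≤? i * i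
  ... | yes p = p
  ... | no  p = contradiction (i*i≤0⇒i≡0 (ℤₚ.i<j⇒i≤pred[j] (ℤₚ.≰⇒> p))) i≢0

  sum-of-squares≤0 : ∀ a b c → a * a + b * b + c * c ≤ 0ℤ → a ≡ 0ℤ × b ≡ 0ℤ × c ≡ 0ℤ
  sum-of-squares≤0 a b c p =
      i*i≤0⇒i≡0 (ℤₚ.≤-trans (bound (0≤+ (0≤i*i b) (0≤i*i c))
        (solve 3 (λ a b c → a :* a :+ (b :* b :+ c :* c) := a :* a :+ b :* b :+ c :* c) refl a b c))
        p)
    , i*i≤0⇒i≡0 (ℤₚ.≤-trans (bound (0≤+ (0≤i*i a) (0≤i*i c))
      (solve 3 (λ a b c → b :* b :+ (a :* a :+ c :* c) := a :* a :+ b :* b :+ c :* c) refl a b c))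
      p)
    , i*i≤0⇒i≡0 (ℤₚ.≤-trans (bound (0≤+ (0≤i*i a) (0≤i*i b))
      (solve 3 (λ a b c → c :* c :+ (a :* a :+ b :* b) := a :* a :+ b :* b :+ c :* c) refl a b c))
      p)
    where
    bound : ∀ {x y z} → 0ℤ ≤ y → x + y ≡ z → x ≤ z
    bound {x} {y} 0≤y refl = subst (_≤ x + y) (ℤₚ.+-identityʳ x) (ℤₚ.+-monoʳ-≤ x 0≤y)

  -- Intended for `d` and `D`, monic quadratics in `t` of discriminant -3: four times such a
  -- polynomial is an integer square plus 3.
  4i>0⇒i>0 : ∀ i j → + 4 * i ≡ j * j + + 3 → 0ℤ < i
  4i>0⇒i>0 i j eq = ℤₚ.*-cancelˡ-<-nonNeg (+ 4)
    (subst (0ℤ <_) (sym eq) (ℤₚ.+-mono-≤-< (0≤i*i j) (+<+ (ℕ.s≤s ℕ.z≤n))))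

  cancel-0≤* : ∀ {i j} → 0ℤ < i → 0ℤ ≤ i * j → 0ℤ ≤ j
  cancel-0≤* {i} {j} 0<i 0≤ij =
    ℤₚ.*-cancelˡ-≤-pos 0ℤ j i {{positive 0<i}} (subst (_≤ i * j) (sym (ℤₚ.*-zeroʳ i)) 0≤ij)

  -- Only a commutative monoid, its units and their action on forms matter here. The form is moved
  -- instead of the element, so that each step compares `one` with the same finitely many `w k`.
  module Descent {T F : Set} (_·_ : T → T → T) (one : T)
    (·-assoc : ∀ x y z → (x · y) · z ≡ x · (y · z))
    (·-comm : ∀ x y → x · y ≡ y · x)
    (·-identityˡ : ∀ x → one · x ≡ x)
    (·-unit : ∀ {u v} → Unit _·_ one u → Unit _·_ one v → Unit _·_ one (u · v))
    (Nonzero : T → Set)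
    (unit·-nonzero : ∀ {u x} → Unit _·_ one u → Nonzero x → Nonzero (u · x))
    (value : F → T → ℤ) (pull : F → T → F)
    (value-pull : ∀ f u x → value (pull f u) x ≡ value f (u · x))
    {n} (w : Fin n → T) (w-unit : ∀ k → Unit _·_ one (w k))
    (local⇒global : ∀ f → (∀ k → value f one ≤ value f (w k)) →
                    ∀ x → Nonzero x → value f one ≤ value f x)
    where

    Minimal : F → T → Set
    Minimal f u = ∀ x → Nonzero x → value f u ≤ value f x

    -- Every nonzero `x` is `u · (u⁻¹ · x)` with `u⁻¹ · x` nonzero, so both forms take the same
    -- values on nonzero elements, with arguments shifted by `u`.
    pull-minimal : ∀ {f u v} → Unit _·_ one u → Minimal (pull f u) v → Minimal f (u · v)
    pull-minimal {f} {u} {v} (unit u⁻¹ uu⁻¹≡1) v-min x x≢0 =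
      subst₂ _≤_ (value-pull f u v)
        (trans (value-pull f u (u⁻¹ · x)) (cong (value f) uu⁻¹x≡x))
        (v-min (u⁻¹ · x) (unit·-nonzero (unit u (trans (·-comm u⁻¹ u) uu⁻¹≡1)) x≢0))
      where
      uu⁻¹x≡x : u · (u⁻¹ · x) ≡ x
      uu⁻¹x≡x = trans (sym (·-assoc u u⁻¹ x)) (trans (cong (_· x) uu⁻¹≡1) (·-identityˡ x))

    -- Descent on value f one: as long as some w k has a smaller value, replace f
    -- by its pull-back along w k.
    minimal-unit : ∀ m f → (∀ x → 0ℤ ≤ value f x) → value f one < + m →
      ∃[ u ] (Unit _·_ one u × Minimal f u)
    minimal-unit ℕ.zero f f≥0 f1<0 = contradiction (f≥0 one) (ℤₚ.<⇒≱ f1<0)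
    minimal-unit (ℕ.suc m) f f≥0 f1≤m with all? (λ k → value f one ≤? value f (w k))
    ... | yes h = one , unit one (·-identityˡ one) , local⇒global f h
    ... | no ¬h =
      let (k , ¬hk) = ¬∀⟶∃¬ n _ (λ k → value f one ≤? value f (w k)) ¬h
          (v , v-unit , v-min) = minimal-unit m (pull f (w k))
            (λ x → subst (0ℤ ≤_) (sym (value-pull f (w k) x)) (f≥0 (w k · x)))
            (subst (_< + m) (sym (trans (value-pull f (w k) one)
              (cong (value f) (trans (·-comm (w k) one) (·-identityˡ (w k))))))
              (ℤₚ.<-≤-trans (ℤₚ.≰⇒> ¬hk) (ℤₚ.i<j⇒i≤pred[j] f1≤m)))
      in w k · v , ·-unit (w-unit k) v-unit , pull-minimal (w-unit k) v-min

  -- Comparison of 1 with its six neighbours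

  module _ (t : ℤ) (-1≤t : -1ℤ ≤ t) where
    open Z t

    0<d : 0ℤ < d
    0<d = 4i>0⇒i>0 d (+ 2 * t + 1ℤ) (prove (t ∷ []) (con (+ 4) :* P.d)
      ((con (+ 2) :* var 0F :+ con 1ℤ) :* (con (+ 2) :* var 0F :+ con 1ℤ) :+ con (+ 3)) refl)

    0<D : 0ℤ < D
    0<D = 4i>0⇒i>0 D (+ 2 * t + + 3) (prove (t ∷ []) (con (+ 4) :* P.D)
      ((con (+ 2) :* var 0F :+ con (+ 3)) :* (con (+ 2) :* var 0F :+ con (+ 3)) :+ con (+ 3)) refl)

    -- The second factor of `E` is `(t + 1)² + 2`.
    0<E : 0ℤ < E
    0<E = subst (_< E) (ℤₚ.*-zeroʳ d) (ℤₚ.*-monoˡ-<-pos d {{positive 0<d}}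
      (subst (0ℤ <_) (prove (t ∷ []) ((t′ :+ con 1ℤ) :* (t′ :+ con 1ℤ) :+ con (+ 2))
      (t′ :* t′ :+ con (+ 2) :* t′ :+ con (+ 3)) refl)
          (ℤₚ.+-mono-≤-< (0≤i*i (t + 1ℤ)) (+<+ (ℕ.s≤s ℕ.z≤n)))))
      where t′ = var 0F

    0≤t+1 : 0ℤ ≤ t + 1ℤ
    0≤t+1 = ℤₚ.i≤j⇒0≤j-i -1≤t

    -- A sum of three integer squares below 1 has all three equal to 0, which forces `a` and `c`,
    -- and then `b`, to vanish.
    q₂≥1 : ∀ x → x ≢ zero → 1ℤ ≤ q₂ x
    q₂≥1 (a , b , c) x≢0 with 1ℤ ≤? q₂ (a , b , c)
    ... | yes p = p
    ... | no  p = contradiction (triple a≡0 b≡0 c≡0) x≢0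
      where
      sos : q₂ (a , b , c) ≡ a * a + (a - b + c) * (a - b + c) + c * c
      sos = prove (t ∷ a ∷ b ∷ c ∷ []) (P.q₂ (A , B , C)) (A :* A :+ (A :- B :+ C) :* (A :- B :+ C)
        :+ C :* C) refl
        where A = var 1F ; B = var 2F ; C = var 3F
      zeros = sum-of-squares≤0 a (a - b + c) c (subst (_≤ 0ℤ) sos (ℤₚ.i<j⇒i≤pred[j] (ℤₚ.≰⇒> p)))
      a≡0 = proj₁ zeros
      c≡0 = proj₂ (proj₂ zeros)
      b≡0 : b ≡ 0ℤ
      b≡0 = begin
        b                   ≡⟨ solve 3 (λ a b c → b := a :+ c :- (a :- b :+ c)) refl a b c ⟩
        a + c - (a - b + c) ≡⟨ cong₂ _-_ (cong₂ _+_ a≡0 c≡0) (proj₁ (proj₂ zeros)) ⟩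
        0ℤ                  ∎
        where open ≡-Reasoning

    -- Definiteness over the integers would only give 1, hence the split on `c`. If `c` is nonzero,
    -- the summand `(t + 3)c²` alone is at least 2; this is where `t ≥ -1` enters. If `c` is 0, the
    -- value is twice `a² - ab + b²`, and positivity of the latter suffices.
    q₁≥2 : ∀ x → x ≢ zero → 0ℤ ≤ q₁ x - 1ℤ - 1ℤ
    q₁≥2 (a , b , c) x≢0 with c ≟ 0ℤ
    ... | no c≢0 = subst (0ℤ ≤_) (sym sos)
        (0≤+ (0≤+ (0≤+ (0≤+ (0≤i*i (a - b + c)) (0≤i*i (a + c))) (0≤i*i (b + t * c)))
          (0≤* 0≤t+1 (0≤i*i c)))
             (0≤* {+ 2} (+≤+ ℕ.z≤n) (ℤₚ.i≤j⇒0≤j-i (i≢0⇒1≤i*i c≢0))))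
      where
      sos : q₁ (a , b , c) - 1ℤ - 1ℤ ≡ (a - b + c) * (a - b + c) + (a + c) * (a + c) + (b + t * c) *
        (b + t * c) + (t + 1ℤ) * (c * c) + + 2 * (c * c - 1ℤ)
      sos = prove (t ∷ a ∷ b ∷ c ∷ []) (P.q₁ (A , B , C) :- con 1ℤ :- con 1ℤ)
        ((A :- B :+ C) :* (A :- B :+ C) :+ (A :+ C) :* (A :+ C) :+ (B :+ T :* C) :* (B :+ T :* C) :+
          (T :+ con 1ℤ) :* (C :* C) :+ con (+ 2) :* (C :* C :- con 1ℤ)) refl
        where T = var 0F ; A = var 1F ; B = var 2F ; C = var 3F
    ... | yes refl with 1ℤ ≤? a * a - a * b + b * b
    ...   | yes p = subst (0ℤ ≤_) eq (0≤* {+ 2} (+≤+ ℕ.z≤n) (ℤₚ.i≤j⇒0≤j-i p))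
      where
      eq : + 2 * (a * a - a * b + b * b - 1ℤ) ≡ q₁ (a , b , 0ℤ) - 1ℤ - 1ℤ
      eq = prove (t ∷ a ∷ b ∷ []) (con (+ 2) :* (A :* A :- A :* B :+ B :* B :- con 1ℤ))
        (P.q₁ (A , B , con 0ℤ) :- con 1ℤ :- con 1ℤ) refl
        where A = var 1F ; B = var 2F
    ...   | no  p = contradiction (triple (proj₁ zeros) (proj₁ (proj₂ zeros)) refl) x≢0
      where
      zeros = sum-of-squares≤0 a b (a - b)
        (subst (_≤ 0ℤ) (solve 2 (λ a b → con (+ 2) :* (a :* a :- a :* b :+ b :* b) :=
          a :* a :+ b :* b :+ (a :- b) :* (a :- b)) refl a b)
          (ℤₚ.*-monoˡ-≤-nonNeg (+ 2) (ℤₚ.i<j⇒i≤pred[j] (ℤₚ.≰⇒> p))))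

    unit·x≢0 : ∀ {u x} → IsUnit u → x ≢ zero → u · x ≢ zero
    unit·x≢0 {u} {x} (unit v uv≡1) x≢0 ux≡0 = x≢0 (begin
      x           ≡⟨ ·-identityˡ t x ⟨
      one · x     ≡⟨ cong (_· x) (trans (sym uv≡1) (·-comm t u v)) ⟩
      (v · u) · x ≡⟨ ·-assoc t v u x ⟩
      v · (u · x) ≡⟨ cong (v ·_) ux≡0 ⟩
      v · zero    ≡⟨ ·-zeroʳ v ⟩
      zero        ∎)
      where
      open ≡-Reasoning
      ·-zeroʳ : ∀ v → v · zero ≡ zero
      ·-zeroʳ (a , b , c) = prove³ (t ∷ a ∷ b ∷ c ∷ []) ((var 1F , var 2F , var 3F) P.· P.zero)
        P.zero refl refl refl

    sq-· : ∀ u x → sq (u · x) ≡ sq u · sq x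
    sq-· u x = begin
      (u · x) · (u · x) ≡⟨ ·-assoc t u x (u · x) ⟩
      u · (x · (u · x)) ≡⟨ cong (u ·_)
        (trans (sym (·-assoc t x u x)) (trans (cong (_· x) (·-comm t x u)) (·-assoc t u x x))) ⟩
      u · (u · (x · x)) ≡⟨ ·-assoc t u u (x · x) ⟨
      (u · u) · (x · x) ∎
      where open ≡-Reasoning

    ·-unit : ∀ {u v} → IsUnit u → IsUnit v → IsUnit (u · v)
    ·-unit {u} {v} (unit u′ uu′≡1) (unit v′ vv′≡1) = unit (v′ · u′) (begin
      (u · v) · (v′ · u′) ≡⟨ ·-assoc t u v (v′ · u′) ⟩
      u · (v · (v′ · u′)) ≡⟨ cong (u ·_) (sym (·-assoc t v v′ u′)) ⟩
      u · ((v · v′) · u′) ≡⟨ cong (λ z → u · (z · u′)) vv′≡1 ⟩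
      u · (one · u′)      ≡⟨ cong (u ·_) (·-identityˡ t u′) ⟩
      u · u′              ≡⟨ uu′≡1 ⟩
      one                 ∎)
      where open ≡-Reasoning

    module _ (x : Triple) (x≢0 : x ≢ zero) where

      private
        -- Each facet is `L₁` or `L₂` after multiplication by a unit square, so its bound at `sq x`
        -- is the bound on `q₁` or `q₂` at a unit multiple of `x`, which is again nonzero.
        q₁-bound : ∀ u → IsUnit u → 0ℤ ≤ ⟨ L₁ ∣ sq u · sq x ⟩ - 1ℤ - 1ℤ
        q₁-bound u u-unit = subst (λ y → 0ℤ ≤ ⟨ L₁ ∣ y ⟩ - 1ℤ - 1ℤ) (sq-· u x)
          (q₁≥2 (u · x) (unit·x≢0 u-unit x≢0))

        q₂-bound : ∀ u → IsUnit u → 0ℤ ≤ ⟨ L₂ ∣ sq u · sq x ⟩ - 1ℤ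
        q₂-bound u u-unit = subst (λ y → 0ℤ ≤ ⟨ L₂ ∣ y ⟩ - 1ℤ) (sq-· u x)
          (ℤₚ.i≤j⇒0≤j-i (q₂≥1 (u · x) (unit·x≢0 u-unit x≢0)))

      -- The signs of the diagonals select the cone containing `sq x - 1`. A nonnegative
      -- `diagonal k` is the missing coefficient of the corner at `w (2k+1)`, whose other two are
      -- facet bounds; if all three diagonals are negative, their negatives are the coefficients of
      -- the central cone.
      gap≥0 : ∀ f → (∀ k → 0ℤ ≤ gap f (sq (w k))) → 0ℤ ≤ gap f (sq x)
      gap≥0 f h = cases (0ℤ ≤? diagonal 0F (sq x)) (0ℤ ≤? diagonal 1F (sq x))
        (0ℤ ≤? diagonal 2F (sq x))
        where
        flip : ∀ {i} → ¬ 0ℤ ≤ i → 0ℤ ≤ - i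
        flip p = ℤₚ.neg-mono-≤ (ℤₚ.<⇒≤ (ℤₚ.≰⇒> p))
        cases : Dec (0ℤ ≤ diagonal 0F (sq x)) → Dec (0ℤ ≤ diagonal 1F (sq x)) →
          Dec (0ℤ ≤ diagonal 2F (sq x)) → 0ℤ ≤ gap f (sq x)
        cases (yes p) _ _ = cancel-0≤* 0<D (subst (0ℤ ≤_) (sym (corner₀ t f (sq x)))
          (0≤+ (0≤+ (0≤* (0≤* (ℤₚ.<⇒≤ 0<D) (q₂-bound θ (w-unit t 0F))) (h 0F)) (0≤* p (h 1F)))
               (0≤* (q₁≥2 x x≢0) (h 2F))))
        cases (no _) (yes p) _ = cancel-0≤* 0<D (subst (0ℤ ≤_) (sym (corner₁ t f (sq x)))
          (0≤+ (0≤+ (0≤* (0≤* (ℤₚ.<⇒≤ 0<D)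
            (q₂-bound (θ · θ+1) (·-unit (w-unit t 0F) (w-unit t 1F)))) (h 2F)) (0≤* p (h 3F)))
               (0≤* (q₁-bound θ (w-unit t 0F)) (h 4F))))
        cases (no _) (no _) (yes p) = cancel-0≤* 0<D (subst (0ℤ ≤_) (sym (corner₂ t f (sq x)))
          (0≤+ (0≤+ (0≤* (0≤* (ℤₚ.<⇒≤ 0<D) (q₂-bound θ+1 (w-unit t 1F))) (h 4F)) (0≤* p (h 5F)))
               (0≤* (q₁-bound θ+1 (w-unit t 1F)) (h 0F))))
        cases (no p) (no q) (no r) = cancel-0≤* 0<E (subst (0ℤ ≤_) (sym (centre t f (sq x)))
          (0≤+ (0≤+ (0≤* (flip q) (h 0F)) (0≤* (flip r) (h 2F))) (0≤* (flip p) (h 4F))))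

    value : Triple → Triple → ℤ
    value f x = ⟨ f ∣ sq x ⟩

    value-pull : ∀ f u x → value (pull f (sq u)) x ≡ value f (u · x)
    value-pull f u x = sym (trans (cong (λ y → ⟨ f ∣ y ⟩) (sq-· u x))
      (pull-correct t f (sq u) (sq x)))

    local⇒global : ∀ f → (∀ k → value f one ≤ value f (w k)) →
                   ∀ x → x ≢ zero → value f one ≤ value f x
    local⇒global f h x x≢0 = subst (λ y → ⟨ f ∣ y ⟩ ≤ value f x) (sym (·-identityˡ t one))
      (ℤₚ.0≤i-j⇒j≤i (gap≥0 x x≢0 f λ k →
        ℤₚ.i≤j⇒0≤j-i (subst (λ y → ⟨ f ∣ y ⟩ ≤ value f (w k)) (·-identityˡ t one) (h k))))

    open Descent _·_ one (·-assoc t) (·-comm t) (·-identityˡ t) ·-unit (_≢ zero) unit·x≢0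
      value (λ f u → pull f (sq u)) value-pull w (w-unit t) local⇒global public
      using (minimal-unit)

-- The norm form has no nontrivial zero

module NormForm where

  open Identities using (module Z; module P; prove³)
  open import Data.Bool.Base using (Bool; true; false; _xor_; _∧_)
  open import Data.Product.Base using (_×_; _,_; ∃-syntax)
  open import Data.Integer.Base
  open import Data.Integer.Solver
  import Data.Integer.DivMod as ℤ
  import Data.Integer.Properties as ℤₚ
  open import Relation.Binary.PropositionalEquality
  open import Data.Vec.Base using (_∷_; [])
  open import Data.Fin.Patterns
  import Data.Nat.Base as ℕ
  import Data.Nat.Properties as ℕₚ
  open import Relation.Nullary using (¬_; contradiction)
  open import Function.Base using (id)
  open +-*-Solver

  bit : Bool → ℤ
  bit true  = 1ℤ
  bit false = 0ℤ

  -- Congruence modulo 2 as a relation instead of a parity function, so that `CubicRelation` carries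
  -- the whole norm computation over to the field with two elements.
  record _~_ (i : ℤ) (b : Bool) : Set where
    constructor parity
    field
      half  : ℤ
      split : i ≡ + 2 * half + bit b

  parity-of : ∀ i → ∃[ b ] i ~ b
  parity-of i with i ℤ.%ℕ 2 | ℤ.n%ℕd<d i 2 | ℤ.a≡a%ℕn+[a/ℕn]*n i 2
  ... | 0 | _ | eq = false , parity (i ℤ./ℕ 2)
    (trans eq (solve 1 (λ k → con 0ℤ :+ k :* con (+ 2) := con (+ 2) :* k :+ con 0ℤ) refl
    (i ℤ./ℕ 2)))
  ... | 1 | _ | eq = true , parity (i ℤ./ℕ 2)
    (trans eq (solve 1 (λ k → con 1ℤ :+ k :* con (+ 2) := con (+ 2) :* k :+ con 1ℤ) refl
    (i ℤ./ℕ 2)))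
  ... | ℕ.suc (ℕ.suc _) | ℕ.s≤s (ℕ.s≤s ()) | _

  ~-+ : ∀ {i a j b} → i ~ a → j ~ b → (i + j) ~ (a xor b)
  ~-+ {a = false} {b = b} (parity k refl) (parity l refl) = parity (k + l)
    (solve 3 (λ k l b → con (+ 2) :* k :+ con 0ℤ :+ (con (+ 2) :* l :+ b) :=
      con (+ 2) :* (k :+ l) :+ b) refl k l (bit b))
  ~-+ {a = true} {b = false} (parity k refl) (parity l refl) = parity (k + l)
    (solve 2 (λ k l → con (+ 2) :* k :+ con 1ℤ :+ (con (+ 2) :* l :+ con 0ℤ) :=
      con (+ 2) :* (k :+ l) :+ con 1ℤ) refl k l)
  ~-+ {a = true} {b = true} (parity k refl) (parity l refl) = parity (k + l + 1ℤ)
    (solve 2 (λ k l → con (+ 2) :* k :+ con 1ℤ :+ (con (+ 2) :* l :+ con 1ℤ) :=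
      con (+ 2) :* (k :+ l :+ con 1ℤ) :+ con 0ℤ) refl k l)

  ~-* : ∀ {i a j b} → i ~ a → j ~ b → (i * j) ~ (a ∧ b)
  ~-* {a = false} {j} (parity k refl) _ = parity (k * j)
    (solve 2 (λ k j → (con (+ 2) :* k :+ con 0ℤ) :* j := con (+ 2) :* (k :* j) :+ con 0ℤ) refl k j)
  ~-* {a = true} {j} {b} (parity k refl) (parity l refl) = parity (k * j + l)
    (solve 3 (λ k l b → (con (+ 2) :* k :+ con 1ℤ) :* (con (+ 2) :* l :+ b) :=
      con (+ 2) :* (k :* (con (+ 2) :* l :+ b) :+ l) :+ b) refl k l (bit b))

  ~-neg : ∀ {i a} → i ~ a → (- i) ~ a
  ~-neg {a = a} (parity k refl) = parity (- (k + bit a))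
    (solve 2 (λ k a → :- (con (+ 2) :* k :+ a) := con (+ 2) :* (:- (k :+ a)) :+ a) refl k (bit a))

  0≁true : ¬ 0ℤ ~ true
  0≁true (parity (+ ℕ.zero) ())
  0≁true (parity +[1+ n ] ())
  0≁true (parity -[1+ ℕ.zero ] ())
  0≁true (parity -[1+ ℕ.suc n ] ())

  module 𝔽₂ (s : Bool) = CubicOrder _xor_ _∧_ id false true s

  -- x³ + x + 1 and x³ + x² + 1, the two possible reductions of P_t modulo 2, are
  -- irreducible.
  norm-𝔽₂ : ∀ s x → 𝔽₂.norm s x ≡ false → x ≡ (false , false , false)
  norm-𝔽₂ s (false , false , false) _ = refl
  norm-𝔽₂ false (false , false , true) ()
  norm-𝔽₂ false (false , true , false) ()
  norm-𝔽₂ false (false , true , true) ()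
  norm-𝔽₂ false (true , false , false) ()
  norm-𝔽₂ false (true , false , true) ()
  norm-𝔽₂ false (true , true , false) ()
  norm-𝔽₂ false (true , true , true) ()
  norm-𝔽₂ true (false , false , true) ()
  norm-𝔽₂ true (false , true , false) ()
  norm-𝔽₂ true (false , true , true) ()
  norm-𝔽₂ true (true , false , false) ()
  norm-𝔽₂ true (true , false , true) ()
  norm-𝔽₂ true (true , true , false) ()
  norm-𝔽₂ true (true , true , true) ()

  module _ (t : ℤ) where
    open Z t

    -- A matrix times its adjugate is its determinant. In field terms `adj x` is the product of the
    -- other two conjugates of `x`.
    ·-adj : ∀ x → x · adj x ≡ (norm x , 0ℤ , 0ℤ)
    ·-adj (a , b , c) = prove³ (t ∷ a ∷ b ∷ c ∷ []) (X P.· P.adj X) (P.norm X , con 0ℤ , con 0ℤ)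
      refl refl refl
      where X = var 1F , var 2F , var 3F

    -- The norm of the reduced triple is the reduction of the norm. It cannot be 1, since 0 is not
    -- odd, and over the field with two elements only the zero triple has norm 0.
    norm≡0⇒even : ∀ a b c → norm (a , b , c) ≡ 0ℤ → a ~ false × b ~ false × c ~ false
    norm≡0⇒even a b c N≡0 = conclude (parity-of t) (parity-of a) (parity-of b) (parity-of c)
      where
      conclude : ∃[ s ] t ~ s → ∃[ p ] a ~ p → ∃[ q ] b ~ q → ∃[ r ] c ~ r → a ~ false × b ~ false ×
        c ~ false
      conclude (s , t~s) (p , a~p) (q , b~q) (r , c~r) =
        finish (norm-𝔽₂ s (p , q , r) (N-even _ refl)) a~p b~q c~r
        where
        open CubicRelation _~_ {0# = 0ℤ} {1# = 1ℤ} {0#′ = false} {1#′ = true} ~-+ ~-* ~-neg (parity 0ℤ refl) (parity 0ℤ refl) t~s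
        N-even : ∀ n → 𝔽₂.norm s (p , q , r) ≡ n → n ≡ false
        N-even false _ = refl
        N-even true eq = contradiction (subst₂ _~_ N≡0 eq (R-norm (a~p , b~q , c~r))) 0≁true
        finish : ∀ {p q r} → (p , q , r) ≡ (false , false , false) → a ~ p → b ~ q → c ~ r →
          a ~ false × b ~ false × c ~ false
        finish refl a~ b~ c~ = a~ , b~ , c~

    norm-double : ∀ a b c → norm (+ 2 * a , + 2 * b , + 2 * c) ≡ + 8 * norm (a , b , c)
    norm-double a b c = prove (t ∷ a ∷ b ∷ c ∷ [])
      (P.norm (dbl (var 1F) , dbl (var 2F) , dbl (var 3F)))
      (con (+ 8) :* P.norm (var 1F , var 2F , var 3F)) refl
      where
      dbl : ∀ {n} → Polynomial n → Polynomial n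
      dbl p = con (+ 2) :* p

    private
      size : Triple → ℕ.ℕ
      size (a , b , c) = ∣ a ∣ ℕ.+ ∣ b ∣ ℕ.+ ∣ c ∣

    -- Infinite descent at the prime 2: a zero of the norm has even coordinates, halving them gives
    -- another zero because the norm is homogeneous of degree three, and the sum of absolute values
    -- is halved.
    norm≡0-bounded : ∀ n x → size x ℕ.≤ n → norm x ≡ 0ℤ → x ≡ zero
    norm≡0-bounded ℕ.zero (+ ℕ.zero , + ℕ.zero , + ℕ.zero) _ _ = refl
    norm≡0-bounded (ℕ.suc n) (a , b , c) s≤n N≡0 = halve (norm≡0⇒even a b c N≡0)
      where
      halve : a ~ false × b ~ false × c ~ false → (a , b , c) ≡ zero
      halve (parity a′ a≡ , parity b′ b≡ , parity c′ c≡) = go (trans a≡ (ℤₚ.+-identityʳ _))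
        (trans b≡ (ℤₚ.+-identityʳ _)) (trans c≡ (ℤₚ.+-identityʳ _))
        where
        -- Halving does not decrease size 0, but that size satisfies the smaller bound anyway.
        shrink : ∀ m → 2 ℕ.* m ℕ.≤ ℕ.suc n → m ℕ.≤ n
        shrink ℕ.zero _ = ℕ.z≤n
        shrink (ℕ.suc m) (ℕ.s≤s le) = ℕₚ.≤-trans (ℕₚ.m≤n+m (ℕ.suc m) m)
          (subst (λ z → m ℕ.+ z ℕ.≤ n) (ℕₚ.+-identityʳ (ℕ.suc m)) le)
        go : a ≡ + 2 * a′ → b ≡ + 2 * b′ → c ≡ + 2 * c′ → (a , b , c) ≡ zero
        go refl refl refl = double (norm≡0-bounded n (a′ , b′ , c′)
          (shrink _ (subst (ℕ._≤ ℕ.suc n) size-double s≤n)) N′≡0)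
          where
          double : (a′ , b′ , c′) ≡ zero → (+ 2 * a′ , + 2 * b′ , + 2 * c′) ≡ zero
          double refl = refl
          N′≡0 : norm (a′ , b′ , c′) ≡ 0ℤ
          N′≡0 = ℤₚ.*-cancelˡ-≡ (+ 8) _ 0ℤ (trans (sym (norm-double a′ b′ c′)) N≡0)
          size-double : size (+ 2 * a′ , + 2 * b′ , + 2 * c′) ≡ 2 ℕ.* size (a′ , b′ , c′)
          size-double = trans (cong₂ ℕ._+_ (cong₂ ℕ._+_ (ℤₚ.abs-* (+ 2) a′) (ℤₚ.abs-* (+ 2) b′))
            (ℤₚ.abs-* (+ 2) c′))
            (trans (cong (ℕ._+ 2 ℕ.* ∣ c′ ∣) (sym (ℕₚ.*-distribˡ-+ 2 ∣ a′ ∣ ∣ b′ ∣)))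
              (sym (ℕₚ.*-distribˡ-+ 2 (∣ a′ ∣ ℕ.+ ∣ b′ ∣) ∣ c′ ∣)))

    norm≡0⇒≡zero : ∀ x → norm x ≡ 0ℤ → x ≡ zero
    norm≡0⇒≡zero x = norm≡0-bounded (size x) x ℕₚ.≤-refl

-- Integers among the rationals, and common denominators

module Rationals where

  open import Data.Integer.Base as ℤ using (ℤ; +_; 1ℤ)
  import Data.Integer.Properties as ℤₚ
  import Data.Nat.Base as ℕ
  open import Data.Product.Base using (_×_; _,_; ∃-syntax)
  open import Data.Rational.Base as ℚ
  open import Data.Rational.Properties as ℚₚ
  import Data.Rational.Unnormalised.Base as ℚᵘ
  import Data.Rational.Unnormalised.Properties as ℚᵘₚ
  open import Data.Rational.Solver
  open import Relation.Binary.PropositionalEquality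
  open +-*-Solver

  fromℤ : ℤ → ℚ
  fromℤ i = i / 1

  private
    toℚᵘ-fromℤ : ∀ i → toℚᵘ (fromℤ i) ℚᵘ.≃ ℚᵘ.mkℚᵘ i 0
    toℚᵘ-fromℤ i = toℚᵘ-fromℚᵘ (ℚᵘ.mkℚᵘ i 0)

  fromℤ-+ : ∀ i j → fromℤ (i ℤ.+ j) ≡ fromℤ i + fromℤ j
  fromℤ-+ i j = toℚᵘ-injective (begin
    toℚᵘ (fromℤ (i ℤ.+ j))                 ≈⟨ toℚᵘ-fromℤ (i ℤ.+ j) ⟩
    ℚᵘ.mkℚᵘ (i ℤ.+ j) 0                    ≈⟨ ℚᵘ.*≡*
      (cong (ℤ._* 1ℤ) (sym (cong₂ ℤ._+_ (ℤₚ.*-identityʳ i) (ℤₚ.*-identityʳ j)))) ⟩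
    ℚᵘ.mkℚᵘ i 0 ℚᵘ.+ ℚᵘ.mkℚᵘ j 0           ≈⟨ ℚᵘₚ.+-cong (toℚᵘ-fromℤ i) (toℚᵘ-fromℤ j) ⟨
    toℚᵘ (fromℤ i) ℚᵘ.+ toℚᵘ (fromℤ j)     ≈⟨ toℚᵘ-homo-+ (fromℤ i) (fromℤ j) ⟨
    toℚᵘ (fromℤ i + fromℤ j)               ∎)
    where open import Relation.Binary.Reasoning.Setoid ℚᵘₚ.≃-setoid

  fromℤ-* : ∀ i j → fromℤ (i ℤ.* j) ≡ fromℤ i * fromℤ j
  fromℤ-* i j = toℚᵘ-injective (begin
    toℚᵘ (fromℤ (i ℤ.* j))                 ≈⟨ toℚᵘ-fromℤ (i ℤ.* j) ⟩
    ℚᵘ.mkℚᵘ i 0 ℚᵘ.* ℚᵘ.mkℚᵘ j 0           ≈⟨ ℚᵘₚ.*-cong (toℚᵘ-fromℤ i) (toℚᵘ-fromℤ j) ⟨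
    toℚᵘ (fromℤ i) ℚᵘ.* toℚᵘ (fromℤ j)     ≈⟨ toℚᵘ-homo-* (fromℤ i) (fromℤ j) ⟨
    toℚᵘ (fromℤ i * fromℤ j)               ∎)
    where open import Relation.Binary.Reasoning.Setoid ℚᵘₚ.≃-setoid

  fromℤ-neg : ∀ i → fromℤ (ℤ.- i) ≡ - fromℤ i
  fromℤ-neg i = toℚᵘ-injective (begin
    toℚᵘ (fromℤ (ℤ.- i))    ≈⟨ toℚᵘ-fromℤ (ℤ.- i) ⟩
    ℚᵘ.- ℚᵘ.mkℚᵘ i 0        ≈⟨ ℚᵘₚ.-‿cong (toℚᵘ-fromℤ i) ⟨
    ℚᵘ.- toℚᵘ (fromℤ i)     ≈⟨ toℚᵘ-homo‿- (fromℤ i) ⟨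
    toℚᵘ (- fromℤ i)        ∎)
    where open import Relation.Binary.Reasoning.Setoid ℚᵘₚ.≃-setoid

  fromℤ-mono-≤ : ∀ {i j} → i ℤ.≤ j → fromℤ i ≤ fromℤ j
  fromℤ-mono-≤ {i} {j} i≤j = toℚᵘ-cancel-≤ (ℚᵘₚ.≤-respˡ-≃ (ℚᵘₚ.≃-sym (toℚᵘ-fromℤ i))
    (ℚᵘₚ.≤-respʳ-≃ (ℚᵘₚ.≃-sym (toℚᵘ-fromℤ j))
    (ℚᵘ.*≤* (ℤₚ.*-monoʳ-≤-nonNeg 1ℤ i≤j))))

  fromℤ-cancel-≤ : ∀ {i j} → fromℤ i ≤ fromℤ j → i ℤ.≤ j
  fromℤ-cancel-≤ {i} {j} le with ℚᵘₚ.≤-respˡ-≃ (toℚᵘ-fromℤ i)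
    (ℚᵘₚ.≤-respʳ-≃ (toℚᵘ-fromℤ j) (toℚᵘ-mono-≤ le))
  ... | ℚᵘ.*≤* p = ℤₚ.*-cancelʳ-≤-pos i j 1ℤ p

  fromℤ-injective : ∀ {i j} → fromℤ i ≡ fromℤ j → i ≡ j
  fromℤ-injective eq = ℤₚ.≤-antisym (fromℤ-cancel-≤ (≤-reflexive eq))
    (fromℤ-cancel-≤ (≤-reflexive (sym eq)))

  *-denominator : ∀ q → q * fromℤ (↧ q) ≡ fromℤ (↥ q)
  *-denominator q@record{} = toℚᵘ-injective (begin
    toℚᵘ (q * fromℤ (↧ q))                 ≈⟨ toℚᵘ-homo-* q (fromℤ (↧ q)) ⟩
    toℚᵘ q ℚᵘ.* toℚᵘ (fromℤ (↧ q))         ≈⟨ ℚᵘₚ.*-cong (ℚᵘₚ.≃-refl {toℚᵘ q}) (toℚᵘ-fromℤ (↧ q)) ⟩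
    toℚᵘ q ℚᵘ.* ℚᵘ.mkℚᵘ (↧ q) 0            ≈⟨ ℚᵘ.*≡* (trans (ℤₚ.*-identityʳ (↥ q ℤ.* ↧ q))
      (cong (λ n → ↥ q ℤ.* (+ n)) (sym (ℕₚ.*-identityʳ (↧ₙ q))))) ⟩
    ℚᵘ.mkℚᵘ (↥ q) 0                        ≈⟨ toℚᵘ-fromℤ (↥ q) ⟨
    toℚᵘ (fromℤ (↥ q))                     ∎)
    where
    open import Relation.Binary.Reasoning.Setoid ℚᵘₚ.≃-setoid
    import Data.Nat.Properties as ℕₚ

  0<* : ∀ {p q} → 0ℚ < p → 0ℚ < q → 0ℚ < p * q
  0<* {p} {q} 0<p 0<q = positive⁻¹ (p * q) {{pos*pos⇒pos p {{positive 0<p}} q {{positive 0<q}}}}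

  ℚ³ ℤ³ : Set
  ℚ³ = ℚ × ℚ × ℚ
  ℤ³ = ℤ × ℤ × ℤ

  fromℤ³ : ℤ³ → ℚ³
  fromℤ³ (a , b , c) = fromℤ a , fromℤ b , fromℤ c

  infixl 7 _•_
  _•_ : ℚ → ℚ³ → ℚ³
  m • (a , b , c) = m * a , m * b , m * c

  -- Reduces questions about `ℚ(θ)` to the order, and later makes the trace form integer valued,
  -- without which the descent need not stop. Only the positivity of `m` matters, so the product of
  -- the denominators will do.
  common-denominator : ∀ x → ∃[ m ] ∃[ z ] (0ℚ < m × m • x ≡ fromℤ³ z)
  common-denominator (a , b , c) =
      fromℤ (↧ a) * fromℤ (↧ b) * fromℤ (↧ c)
    , (↥ a ℤ.* (↧ b ℤ.* ↧ c) , ↥ b ℤ.* (↧ a ℤ.* ↧ c) , ↥ c ℤ.* (↧ a ℤ.* ↧ b))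
    , 0<* (0<* (0<fromℤ↧ a) (0<fromℤ↧ b)) (0<fromℤ↧ c)
    , cong₂ _,_ (clear a b c (solve 4 (λ q x y z → x :* y :* z :* q := q :* x :* (y :* z)) refl a
      (d a) (d b) (d c)))
        (cong₂ _,_ (clear b a c (solve 4 (λ q x y z → x :* y :* z :* q := q :* y :* (x :* z)) refl b
          (d a) (d b) (d c)))
                   (clear c a b (solve 4 (λ q x y z → x :* y :* z :* q := q :* z :* (x :* y)) refl c
                     (d a) (d b) (d c))))
    where
    d : ℚ → ℚ
    d q = fromℤ (↧ q)
    0<fromℤ↧ : ∀ q → 0ℚ < d q
    0<fromℤ↧ q@record{} = <-≤-trans (positive⁻¹ 1ℚ) (fromℤ-mono-≤ {1ℤ} {↧ q} (ℤ.+≤+ (ℕ.s≤s ℕ.z≤n)))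
    clear : ∀ q x y {s} → s ≡ q * d q * (d x * d y) → s ≡ fromℤ (↥ q ℤ.* (↧ x ℤ.* ↧ y))
    clear q x y eq = trans eq (sym (trans (fromℤ-* (↥ q) (↧ x ℤ.* ↧ y))
      (cong₂ _*_ (sym (*-denominator q)) (fromℤ-* (↧ x) (↧ y)))))

-- Linear algebra over an abstract number field

module NumberFields where

  open Identities using (module Z; triple)
  open Rationals
  open import Algebra.Morphism.Structures using (IsRingHomomorphism)
  import Algebra.Solver.Ring as RingSolver
  import Algebra.Solver.Ring.AlmostCommutativeRing as ACR
  open import Data.Fin.Base using (Fin; suc)
  import Data.Nat.Base as ℕ
  open import Level using (_⊔_)
  import Algebra.Definitions.RawMonoid as RawMonoid
  import Algebra.Properties.CommutativeMonoid.Sum as Sum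
  open import Algebra.Apartness.Bundles using (HeytingField)
  import Relation.Binary.Reasoning.Setoid as SetoidReasoning
  open import Data.Integer.Base as ℤ using (ℤ; 0ℤ; 1ℤ)
  open import Data.Maybe.Base using (Maybe; just; nothing)
  open import Data.Product.Base using (_,_; proj₁; proj₂)
  open import Data.Rational.Base as ℚ using (ℚ; 0ℚ; 1ℚ; 1/_)
  import Data.Rational.Properties as ℚₚ
  open import Relation.Binary.PropositionalEquality as ≡ using (_≡_)
  open import Relation.Nullary using (¬_; yes; no; contradiction)

  module ℚΣ = RawMonoid ℚ.+-0-rawMonoid
  module ℚΣₚ = Sum ℚₚ.+-0-commutativeMonoid

  module Q (t : ℤ) = CubicOrder ℚ._+_ ℚ._*_ ℚ.-_ 0ℚ 1ℚ (fromℤ t)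

  infixl 6 _⊞_
  _⊞_ : ℚ³ → ℚ³ → ℚ³
  (a , b , c) ⊞ (a′ , b′ , c′) = a ℚ.+ a′ , b ℚ.+ b′ , c ℚ.+ c′

  record _↦_ (i : ℤ) (q : ℚ) : Set where
    constructor cast
    field
      cast-≡ : fromℤ i ≡ q
  open _↦_ public

  ↦-+ : ∀ {i p j q} → i ↦ p → j ↦ q → (i ℤ.+ j) ↦ (p ℚ.+ q)
  ↦-+ {i} {_} {j} (cast ≡.refl) (cast ≡.refl) = cast (fromℤ-+ i j)

  ↦-* : ∀ {i p j q} → i ↦ p → j ↦ q → (i ℤ.* j) ↦ (p ℚ.* q)
  ↦-* {i} {_} {j} (cast ≡.refl) (cast ≡.refl) = cast (fromℤ-* i j)

  ↦-neg : ∀ {i p} → i ↦ p → (ℤ.- i) ↦ (ℚ.- p)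
  ↦-neg {i} (cast ≡.refl) = cast (fromℤ-neg i)

  module CastRelation (t : ℤ) = CubicRelation _↦_
    {ℤ._+_} {ℤ._*_} {ℤ.-_} {0ℤ} {1ℤ} {t} {ℚ._+_} {ℚ._*_} {ℚ.-_} {0ℚ} {1ℚ} {fromℤ t}
    ↦-+ ↦-* ↦-neg (cast ≡.refl) (cast ≡.refl) (cast ≡.refl)

  ↦-fromℤ³ : ∀ t x → CastRelation.R³ t x (fromℤ³ x)
  ↦-fromℤ³ t _ = cast ≡.refl , cast ≡.refl , cast ≡.refl

  fromℤ³-· : ∀ t x y → fromℤ³ (Z._·_ t x y) ≡ Q._·_ t (fromℤ³ x) (fromℤ³ y)
  fromℤ³-· t x y = let (p , q , r) = CastRelation.R-· t (↦-fromℤ³ t x) (↦-fromℤ³ t y)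
    in triple (cast-≡ p) (cast-≡ q) (cast-≡ r)

  •-cancel : ∀ {m x} → 0ℚ ℚ.< m → m • x ≡ (0ℚ , 0ℚ , 0ℚ) → x ≡ (0ℚ , 0ℚ , 0ℚ)
  •-cancel {m} {a , b , c} 0<m eq = triple (cancel (≡.cong proj₁ eq))
    (cancel (≡.cong (λ z → proj₁ (proj₂ z)) eq)) (cancel (≡.cong (λ z → proj₂ (proj₂ z)) eq))
    where
    cancel : ∀ {q} → m ℚ.* q ≡ 0ℚ → q ≡ 0ℚ
    cancel {q} eq = ℚₚ.≤-antisym
      (ℚₚ.*-cancelˡ-≤-pos m {{ℚ.positive 0<m}} (ℚₚ.≤-reflexive (≡.trans eq (≡.sym (ℚₚ.*-zeroʳ m)))))
      (ℚₚ.*-cancelˡ-≤-pos m {{ℚ.positive 0<m}} (ℚₚ.≤-reflexive (≡.trans (ℚₚ.*-zeroʳ m) (≡.sym eq))))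

  module NumberFieldLemmas {c ℓ₁ ℓ₂} (K : NumberField c ℓ₁ ℓ₂) where
    open NumberField K
    open IsRingHomomorphism ι-isRingHomomorphism using (+-homo; *-homo; -‿homo; 0#-homo; 1#-homo)
    open HeytingField heytingField using (#-irrefl; invertible⇒#)
    module ≈-Reasoning = SetoidReasoning setoid

    ι-cong : ∀ {p q} → p ≡ q → ι p ≈ ι q
    ι-cong ≡.refl = refl

    ι-≟ : ∀ p q → Maybe (ι p ≈ ι q)
    ι-≟ p q with p ℚₚ.≟ q
    ... | yes p≡q = just (ι-cong p≡q)
    ... | no  _   = nothing

    ι-morphism : ℚ.+-*-rawRing ACR.-Raw-AlmostCommutative⟶ ACR.fromCommutativeRing commutativeRing
    ι-morphism = record
      { ⟦_⟧ = ι ; +-homo = +-homo ; *-homo = *-homo ; -‿homo = -‿homo ; 0-homo = 0#-homo ; 1-homo =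
        1#-homo }

    -- Coefficients are rationals read in `K` through `ι`, so normal forms are compared with the
    -- decidable equality of `ℚ`.
    module KSolver = RingSolver ℚ.+-*-rawRing (ACR.fromCommutativeRing commutativeRing) ι-morphism ι-≟

    -- The difference `1# - 0#` is its own inverse up to `≈`, so `1#` and `0#` are apart, and
    -- apartness is irreflexive.
    1≉0 : ¬ 1# ≈ 0#
    1≉0 1≈0 = #-irrefl 1≈0 (invertible⇒# (1# , trans (*-identityˡ _) 1-0≈1 ,
      trans (*-identityʳ _) 1-0≈1))
      where
      1-0≈1 : 1# - 0# ≈ 1#
      1-0≈1 = trans (+-congˡ (trans (-‿cong (sym 1≈0)) refl)) (trans (-‿inverseʳ 1#) (sym 1≈0))

    ι≈0⇒≡0 : ∀ {q} → ι q ≈ 0# → q ≡ 0ℚ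
    ι≈0⇒≡0 {q} ιq≈0 with q ℚₚ.≟ 0ℚ
    ... | yes q≡0 = q≡0
    ... | no  q≢0 = contradiction (begin
      1#                  ≈⟨ 1#-homo ⟨
      ι 1ℚ                ≈⟨ ι-cong (ℚₚ.*-inverseʳ q) ⟨
      ι (q ℚ.* 1/ q)      ≈⟨ *-homo q (1/ q) ⟩
      ι q * ι (1/ q)      ≈⟨ *-congʳ ιq≈0 ⟩
      0# * ι (1/ q)       ≈⟨ zeroˡ _ ⟩
      0#                  ∎) 1≉0
      where
      open ≈-Reasoning
      instance _ = ℚ.≢-nonZero q≢0

    record IsLinear (φ : Carrier → ℚ) : Set (c ⊔ ℓ₁) where
      field
        φ-cong : ∀ {x y} → x ≈ y → φ x ≡ φ y
        φ-+    : ∀ x y → φ (x + y) ≡ φ x ℚ.+ φ y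
        φ-ι    : ∀ q x → φ (ι q * x) ≡ q ℚ.* φ x

      φ-0 : φ 0# ≡ 0ℚ
      φ-0 = ≡.trans (φ-cong (sym (trans (*-congʳ 0#-homo) (zeroˡ 0#))))
        (≡.trans (φ-ι 0ℚ 0#) (ℚₚ.*-zeroˡ (φ 0#)))

      φ-sum : ∀ {n} (q : Fin n → ℚ) (v : Fin n → Carrier) →
              φ (sum (λ i → ι (q i) * v i)) ≡ ℚΣ.sum (λ i → q i ℚ.* φ (v i))
      φ-sum {ℕ.zero}  q v = φ-0
      φ-sum {ℕ.suc n} q v = ≡.trans (φ-+ _ _)
        (≡.cong₂ ℚ._+_ (φ-ι _ _) (φ-sum (λ i → q (suc i)) (λ i → v (suc i))))

    open IsLinear

    ∑-+ : ∀ {n} (q r : Fin n → ℚ) (v : Fin n → Carrier) →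
          sum (λ i → ι (q i ℚ.+ r i) * v i) ≈ sum (λ i → ι (q i) * v i) + sum (λ i → ι (r i) * v i)
    ∑-+ {ℕ.zero}  q r v = sym (+-identityˡ 0#)
    ∑-+ {ℕ.suc n} q r v = trans (+-cong (*-congʳ (+-homo _ _))
      (∑-+ (λ i → q (suc i)) (λ i → r (suc i)) (λ i → v (suc i))))
      (solve 5 (λ a b v s s′ → (a :+ b) :* v :+ (s :+ s′) := a :* v :+ s :+ (b :* v :+ s′)) refl _ _
        _ _ _)
      where open KSolver

    ∑-ι : ∀ {n} p (q : Fin n → ℚ) (v : Fin n → Carrier) →
          sum (λ i → ι (p ℚ.* q i) * v i) ≈ ι p * sum (λ i → ι (q i) * v i)
    ∑-ι {ℕ.zero}  p q v = sym (zeroʳ (ι p))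
    ∑-ι {ℕ.suc n} p q v = trans
      (+-cong (*-congʳ (*-homo _ _)) (∑-ι p (λ i → q (suc i)) (λ i → v (suc i))))
      (solve 4 (λ p q v s → p :* q :* v :+ p :* s := p :* (q :* v :+ s)) refl _ _ _ _)
      where open KSolver

    -- Follows from uniqueness: sums and rational multiples of expansions are expansions of the sums
    -- and multiples.
    coord-linear : ∀ i → IsLinear (λ x → coord x i)
    coord-linear i .φ-cong {x} {y} x≈y = coord-unique y (coord x)
      (trans (sym x≈y) (coord-expansion x)) i
    coord-linear i .φ-+ x y = ≡.sym (coord-unique (x + y) (λ i → coord x i ℚ.+ coord y i)
      (trans (+-cong (coord-expansion x) (coord-expansion y)) (sym (∑-+ (coord x) (coord y) basis)))
        i)
    coord-linear i .φ-ι q x = ≡.sym (coord-unique (ι q * x) (λ i → q ℚ.* coord x i)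
      (trans (*-congˡ (coord-expansion x)) (sym (∑-ι q (coord x) basis))) i)

    -- tr (A B) = tr (B A) for the coordinate matrices A and B between two bases.
    Tr-change-of-basis : (κ₀ κ₁ κ₂ : Carrier → ℚ) (e₀ e₁ e₂ : Carrier) →
      IsLinear κ₀ → IsLinear κ₁ → IsLinear κ₂ →
      (∀ x → x ≈ ι (κ₀ x) * e₀ + ι (κ₁ x) * e₁ + ι (κ₂ x) * e₂) →
      ∀ x → Tr K x ≡ κ₀ (x * e₀) ℚ.+ κ₁ (x * e₁) ℚ.+ κ₂ (x * e₂)
    Tr-change-of-basis κ₀ κ₁ κ₂ e₀ e₁ e₂ l₀ l₁ l₂ expand x = begin
      ℚΣ.sum (λ i → coord (x * basis i) i)
        ≡⟨ ℚΣₚ.sum-cong-≗ diagonal-entry ⟩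
      ℚΣ.sum (λ i → entry κ₀ e₀ i ℚ.+ entry κ₁ e₁ i ℚ.+ entry κ₂ e₂ i)
        ≡⟨ ℚΣₚ.∑-distrib-+ (λ i → entry κ₀ e₀ i ℚ.+ entry κ₁ e₁ i) (entry κ₂ e₂) ⟩
      ℚΣ.sum (λ i → entry κ₀ e₀ i ℚ.+ entry κ₁ e₁ i) ℚ.+ ℚΣ.sum (entry κ₂ e₂)
        ≡⟨ ≡.cong (ℚ._+ ℚΣ.sum (entry κ₂ e₂)) (ℚΣₚ.∑-distrib-+ (entry κ₀ e₀) (entry κ₁ e₁)) ⟩
      ℚΣ.sum (entry κ₀ e₀) ℚ.+ ℚΣ.sum (entry κ₁ e₁) ℚ.+ ℚΣ.sum (entry κ₂ e₂)
        ≡⟨ ≡.cong₂ ℚ._+_ (≡.cong₂ ℚ._+_ (sum-entry l₀ e₀) (sum-entry l₁ e₁)) (sum-entry l₂ e₂) ⟩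
      κ₀ (x * e₀) ℚ.+ κ₁ (x * e₁) ℚ.+ κ₂ (x * e₂) ∎
      where
      open ≡.≡-Reasoning
      entry : (Carrier → ℚ) → Carrier → Fin degree → ℚ
      entry κ e i = coord e i ℚ.* κ (x * basis i)
      diagonal-entry : ∀ i → coord (x * basis i) i ≡ entry κ₀ e₀ i ℚ.+ entry κ₁ e₁ i ℚ.+ entry κ₂ e₂
        i
      diagonal-entry i = ≡.trans (φ-cong l (expand y))
        (≡.trans (φ-+ l _ _) (≡.cong₂ ℚ._+_
          (≡.trans (φ-+ l _ _) (≡.cong₂ ℚ._+_ (term κ₀ e₀) (term κ₁ e₁))) (term κ₂ e₂)))
        where
        y = x * basis i
        l = coord-linear i
        term : ∀ κ e → coord (ι (κ y) * e) i ≡ entry κ e i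
        term κ e = ≡.trans (φ-ι l (κ y) e) (ℚₚ.*-comm (κ y) (coord e i))
      sum-entry : ∀ {κ} → IsLinear κ → ∀ e → ℚΣ.sum (entry κ e) ≡ κ (x * e)
      sum-entry {κ} l e = ≡.trans (≡.sym (φ-sum l (coord e) (λ i → x * basis i)))
        (φ-cong l (trans (*-sum (coord e)) (*-congˡ (sym (coord-expansion e)))))
        where
        *-sum′ : ∀ {n} (q : Fin n → ℚ) (v : Fin n → Carrier) → sum (λ i → ι (q i) * (x * v i)) ≈ x *
          sum (λ i → ι (q i) * v i)
        *-sum′ {ℕ.zero}  q v = sym (zeroʳ x)
        *-sum′ {ℕ.suc n} q v = trans (+-congˡ (*-sum′ (λ i → q (suc i)) (λ i → v (suc i))))
          (solve 4 (λ q x v s → q :* (x :* v) :+ x :* s := x :* (q :* v :+ s)) refl _ _ _ _)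
          where open KSolver
        *-sum : ∀ q → sum (λ i → ι (q i) * (x * basis i)) ≈ x * sum (λ i → ι (q i) * basis i)
        *-sum q = *-sum′ q basis

-- The basis `1, θ, θ²` of `K`

module PowerBases where

  open Identities using (module Z; triple)
  open NormForm using (·-adj; norm≡0⇒≡zero)
  open Rationals
  open NumberFields
  open import Algebra.Morphism.Structures using (IsRingHomomorphism)
  open import Algebra.Apartness.Bundles using (HeytingField)
  open import Data.Fin.Patterns
  open import Data.Integer.Base as ℤ using (ℤ; +_; 0ℤ)
  open import Data.List.Base using (List; []; _∷_; map)
  open import Data.Product.Base using (_,_; proj₁; proj₂; ∃-syntax)
  open import Data.Rational.Base as ℚ using (ℚ; 0ℚ; 1ℚ; 1/_)
  import Data.Rational.Properties as ℚₚ
  import Data.Rational.Solver as ℚSolver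
  open import Data.Vec.Base using (_∷_; [])
  open import Relation.Binary.PropositionalEquality as ≡ using (_≡_; _≢_)

  module PowerBasis {c ℓ₁ ℓ₂} (K : NumberField c ℓ₁ ℓ₂)
    (t : ℤ) (θ : NumberField.Carrier K)
    (θ-root : NumberField._≈_ K (evalℤ K (simplestCubic t) θ) (NumberField.0# K))
    where
    open NumberField K
    open NumberFieldLemmas K
    open IsRingHomomorphism ι-isRingHomomorphism using (+-homo; *-homo; -‿homo; 0#-homo; 1#-homo)
    open HeytingField heytingField using (#-irrefl)
    open IsLinear

    module ℤ[θ] = Z t
    module ℚ[θ] = Q t
    -- The constants are images under `ι` because this is how `KSolver` reads `con 0ℚ` and `con 1ℚ`;
    -- it also lets `ιRelation` start from reflexivity.
    module KC = CubicOrder _+_ _*_ -_ (ι 0ℚ) (ι 1ℚ) (ι (fromℤ t))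

    module ιRelation = CubicRelation (λ q x → ι q ≈ x)
      {ℚ._+_} {ℚ._*_} {ℚ.-_} {0ℚ} {1ℚ} {fromℤ t} {_+_} {_*_} { -_} {ι 0ℚ} {ι 1ℚ} {ι (fromℤ t)}
      (λ p q → trans (+-homo _ _) (+-cong p q)) (λ p q → trans (*-homo _ _) (*-cong p q))
      (λ p → trans (-‿homo _) (-‿cong p)) refl refl refl

    ev : KC.Triple → Carrier
    ev (a , b , c) = a + b * θ + c * (θ * θ)

    emb : ℚ³ → Carrier
    emb (a , b , c) = ev (ι a , ι b , ι c)

    ev-cong : ∀ {a a′ b b′ c c′} → a ≈ a′ → b ≈ b′ → c ≈ c′ → ev (a , b , c) ≈ ev (a′ , b′ , c′)
    ev-cong p q r = +-cong (+-cong p (*-congʳ q)) (*-congʳ r)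

    P[θ] : Carrier
    P[θ] = θ * (θ * θ) - ι (fromℤ t) * (θ * θ) - KC.e * θ - ι 1ℚ

    P[θ]≈0 : P[θ] ≈ 0#
    P[θ]≈0 = begin
      P[θ] ≈⟨ solve 3 (λ x t e → x :* (x :* x) :- t :* (x :* x) :- e :* x :- con 1ℚ
                 := con (ℚ.- 1ℚ) :+ x :* (:- e :+ x :* (:- t :+ x :* (con 1ℚ :+ x :* con 0ℚ)))) refl
                   θ (ι (fromℤ t)) KC.e ⟩
      ι (ℚ.- 1ℚ) + θ * (- KC.e + θ * (- ι (fromℤ t) + θ * (ι 1ℚ + θ * ι 0ℚ)))
        ≈⟨ +-congˡ (*-congˡ (+-cong (sym e-coeff)
          (*-congˡ (+-cong (sym t-coeff) (*-congˡ (+-congˡ (*-congˡ 0#-homo))))))) ⟩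
      evalℤ K (simplestCubic t) θ ≈⟨ θ-root ⟩
      0# ∎
      where
      open ≈-Reasoning
      open KSolver
      t-coeff : ι (fromℤ (ℤ.- t)) ≈ - ι (fromℤ t)
      t-coeff = trans (ι-cong (fromℤ-neg t)) (-‿homo _)
      e-coeff : ι (fromℤ (ℤ.- (t ℤ.+ + 3))) ≈ - KC.e
      e-coeff = trans (ι-cong (≡.trans (fromℤ-neg (t ℤ.+ + 3)) (≡.cong ℚ.-_ (fromℤ-+ t (+ 3)))))
        (trans (-‿homo _) (-‿cong ιRelation.R-e))

    -- Division with remainder: the product of two quadratic polynomials in `θ` is its reduced form
    -- plus `k` times the cubic. The quotient is `d₃ + d₄(θ + t)`, as `θ³` contributes 1 and `θ⁴`
    -- contributes `θ + t`.
    ev-· : ∀ x y → ev (x KC.· y) ≈ ev x * ev y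
    ev-· x@(a₀ , a₁ , a₂) y@(b₀ , b₁ , b₂) = begin
      ev (x KC.· y)                ≈⟨ +-identityʳ _ ⟨
      ev (x KC.· y) + 0#           ≈⟨ +-congˡ (trans (*-congˡ P[θ]≈0) (zeroʳ k)) ⟨
      ev (x KC.· y) + k * P[θ]     ≈⟨ prove (ι (fromℤ t) ∷ a₀ ∷ a₁ ∷ a₂ ∷ b₀ ∷ b₁ ∷ b₂ ∷ θ ∷ [])
                                        (evP (X P.· Y) :+ (d₃ :+ d₄ :* (Θ :+ var 0F)) :*
                                          (Θ :* (Θ :* Θ) :- var 0F :* (Θ :* Θ)
                                            :- P.e :* Θ :- con 1ℚ))
                                        (evP X :* evP Y) refl ⟩
      ev x * ev y                  ∎
      where
      open ≈-Reasoning
      open KSolver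
      module P = CubicOrder {A = Polynomial 8} _:+_ _:*_ :-_ (con 0ℚ) (con 1ℚ) (var 0F)
      k = a₁ * b₂ + a₂ * b₁ + a₂ * b₂ * (θ + ι (fromℤ t))
      Θ d₃ d₄ : Polynomial 8
      Θ = var 7F
      X Y : P.Triple
      X = var 1F , var 2F , var 3F
      Y = var 4F , var 5F , var 6F
      d₃ = var 2F :* var 6F :+ var 3F :* var 5F
      d₄ = var 3F :* var 6F
      evP : P.Triple → Polynomial 8
      evP (a , b , c) = a :+ b :* Θ :+ c :* (Θ :* Θ)

    emb-cong : ∀ {x y} → x ≡ y → emb x ≈ emb y
    emb-cong ≡.refl = refl

    emb-· : ∀ x y → emb (x ℚ[θ].· y) ≈ emb x * emb y
    emb-· x y = let (p , q , r) = ιRelation.R-· {x} {_} {y} (refl , refl , refl)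
                      (refl , refl , refl)
      in trans (ev-cong p q r) (ev-· _ _)

    emb-⊞ : ∀ x y → emb (x ⊞ y) ≈ emb x + emb y
    emb-⊞ _ _ = trans (ev-cong (+-homo _ _) (+-homo _ _) (+-homo _ _))
      (solve 7 (λ θ a b c a′ b′ c′ → (a :+ a′) :+ (b :+ b′) :* θ :+ (c :+ c′) :* (θ :* θ) :=
        a :+ b :* θ :+ c :* (θ :* θ) :+ (a′ :+ b′ :* θ :+ c′ :* (θ :* θ))) refl θ _ _ _ _ _ _)
      where open KSolver

    emb-• : ∀ m x → emb (m • x) ≈ ι m * emb x
    emb-• m x = trans (ev-cong (*-homo _ _) (*-homo _ _) (*-homo _ _))
      (solve 5 (λ θ m a b c → m :* a :+ m :* b :* θ :+ m :* c :* (θ :* θ) :=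
        m :* (a :+ b :* θ :+ c :* (θ :* θ))) refl θ _ _ _ _)
      where open KSolver

    emb-const : ∀ q → emb (q , 0ℚ , 0ℚ) ≈ ι q
    emb-const q = solve 2 (λ q θ → q :+ con 0ℚ :* θ :+ con 0ℚ :* (θ :* θ) := q) refl (ι q) θ
      where open KSolver

    emb-θ : emb ℚ[θ].θ ≈ θ
    emb-θ = solve 1 (λ θ → con 0ℚ :+ con 1ℚ :* θ :+ con 0ℚ :* (θ :* θ) := θ) refl θ
      where open KSolver

    emb-θ² : emb ℚ[θ].θ² ≈ θ * θ
    emb-θ² = solve 1 (λ θ → con 0ℚ :+ con 0ℚ :* θ :+ con 1ℚ :* (θ :* θ) := θ :* θ) refl θ
      where open KSolver

    emb-zero : emb ℚ[θ].zero ≈ 0#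
    emb-zero = trans (emb-const 0ℚ) 0#-homo

    embℤ : ℤ³ → Carrier
    embℤ z = emb (fromℤ³ z)

    embℤ-· : ∀ x y → embℤ (x ℤ[θ].· y) ≈ embℤ x * embℤ y
    embℤ-· x y = trans (emb-cong (fromℤ³-· t x y)) (emb-· (fromℤ³ x) (fromℤ³ y))

    embℤ-one : embℤ ℤ[θ].one ≈ 1#
    embℤ-one = trans (emb-const 1ℚ) 1#-homo

    embℤ-adj : ∀ z → embℤ z * embℤ (ℤ[θ].adj z) ≈ ι (fromℤ (ℤ[θ].norm z))
    embℤ-adj z = trans (sym (embℤ-· z (ℤ[θ].adj z)))
      (trans (emb-cong (≡.cong fromℤ³ (·-adj t z))) (emb-const (fromℤ (ℤ[θ].norm z))))

    -- This is the linear independence of `1, θ, θ²`: multiplied by the adjugate, a relation becomes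
    -- the vanishing of an integer, the norm of its coefficient triple.
    embℤ≈0⇒≡zero : ∀ {z} → embℤ z ≈ 0# → z ≡ ℤ[θ].zero
    embℤ≈0⇒≡zero {z} z≈0 = norm≡0⇒≡zero t z (fromℤ-injective (ι≈0⇒≡0
      (trans (sym (embℤ-adj z)) (trans (*-congʳ z≈0) (zeroˡ _)))))

    emb≈0⇒≡zero : ∀ {x} → emb x ≈ 0# → x ≡ ℚ[θ].zero
    emb≈0⇒≡zero {x} x≈0 =
      let (m , z , 0<m , mx≡z) = common-denominator x
          z≈0 = trans (emb-cong (≡.sym mx≡z))
            (trans (emb-• m x) (trans (*-congˡ x≈0) (zeroʳ (ι m))))
      in •-cancel 0<m (≡.trans mx≡z (≡.cong fromℤ³ (embℤ≈0⇒≡zero {z} z≈0)))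

    emb-injective : ∀ {x y} → emb x ≈ emb y → x ≡ y
    emb-injective {a , b , c} {a′ , b′ , c′} x≈y = triple (sub (≡.cong proj₁ x-y≡0))
      (sub (≡.cong (λ z → proj₁ (proj₂ z)) x-y≡0)) (sub (≡.cong (λ z → proj₂ (proj₂ z)) x-y≡0))
      where
      x = a , b , c
      y = a′ , b′ , c′
      x-y≡0 : x ⊞ (ℚ.- 1ℚ) • y ≡ ℚ[θ].zero
      x-y≡0 = emb≈0⇒≡zero (trans (emb-⊞ x ((ℚ.- 1ℚ) • y)) (trans (+-cong x≈y (emb-• (ℚ.- 1ℚ) y))
        (trans (solve 1 (λ y → y :+ con (ℚ.- 1ℚ) :* y := con 0ℚ) refl (emb y)) 0#-homo)))
        where open KSolver
      sub : ∀ {p q} → p ℚ.+ (ℚ.- 1ℚ) ℚ.* q ≡ 0ℚ → p ≡ q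
      sub {p} {q} eq = ≡.trans (solve 2 (λ p q → p := q :+ (p :+ con (ℚ.- 1ℚ) :* q)) ≡.refl p q)
        (≡.trans (≡.cong (q ℚ.+_) eq) (ℚₚ.+-identityʳ q))
        where open ℚSolver.+-*-Solver

    -- With `z = m x` integral the inverse is `m adj(z) / norm(z)`, where the norm is nonzero
    -- because `z` is.
    emb-invertible : ∀ {x} → x ≢ ℚ[θ].zero → ∃[ y ] emb x * emb y ≈ 1#
    emb-invertible {x} x≢0 = m • (1/ N • fromℤ³ (ℤ[θ].adj z)) , (begin
      emb x * emb (m • (1/ N • z′))      ≈⟨ *-congˡ
        (trans (emb-• m (1/ N • z′)) (*-congˡ (emb-• (1/ N) z′))) ⟩
      emb x * (ι m * (ι (1/ N) * emb z′)) ≈⟨ solve 4 (λ x m n z → x :* (m :* (n :* z)) :=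
        n :* (m :* x :* z)) refl _ _ _ _ ⟩
      ι (1/ N) * (ι m * emb x * emb z′)  ≈⟨ *-congˡ
        (*-congʳ (trans (sym (emb-• m x)) (emb-cong mx≡z))) ⟩
      ι (1/ N) * (embℤ z * emb z′)       ≈⟨ *-congˡ (embℤ-adj z) ⟩
      ι (1/ N) * ι N                     ≈⟨ *-homo (1/ N) N ⟨
      ι (1/ N ℚ.* N)                     ≈⟨ ι-cong (ℚₚ.*-inverseˡ N) ⟩
      ι 1ℚ                               ≈⟨ 1#-homo ⟩
      1#                                 ∎)
      where
      open ≈-Reasoning
      open KSolver
      cd = common-denominator x
      m = proj₁ cd
      z = proj₁ (proj₂ cd)
      mx≡z = proj₂ (proj₂ (proj₂ cd))
      z′ = fromℤ³ (ℤ[θ].adj z)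
      N = fromℤ (ℤ[θ].norm z)
      N≢0 : N ≢ 0ℚ
      N≢0 N≡0 = x≢0 (•-cancel (proj₁ (proj₂ (proj₂ cd)))
        (≡.trans mx≡z (≡.cong fromℤ³ (norm≡0⇒≡zero t z (fromℤ-injective N≡0)))))
      instance _ = ℚ.≢-nonZero N≢0

    -- Horner's rule modulo the cubic.
    coeffs : List ℚ → ℚ³
    coeffs []       = ℚ[θ].zero
    coeffs (q ∷ qs) = (q , 0ℚ , 0ℚ) ⊞ ℚ[θ].θ ℚ[θ].· coeffs qs

    eval-coeffs : ∀ p → eval K p θ ≈ emb (coeffs p)
    eval-coeffs []       = sym emb-zero
    eval-coeffs (q ∷ qs) = sym (trans (emb-⊞ (q , 0ℚ , 0ℚ) (ℚ[θ].θ ℚ[θ].· coeffs qs))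
      (+-cong (emb-const q) (trans (emb-· ℚ[θ].θ (coeffs qs))
        (*-cong emb-θ (sym (eval-coeffs qs))))))

    coeffs-integral : ∀ p → ∃[ z ] coeffs (map (ℚ._/ 1) p) ≡ fromℤ³ z
    coeffs-integral []      = ℤ[θ].zero , ≡.refl
    coeffs-integral (i ∷ p) with coeffs-integral p
    ... | z , eq = (i ℤ.+ z₀ , 0ℤ ℤ.+ z₁ , 0ℤ ℤ.+ z₂) , ≡.trans (≡.cong ((fromℤ i , 0ℚ , 0ℚ) ⊞_)
        (≡.trans (≡.cong (ℚ[θ].θ ℚ[θ].·_) eq) (≡.sym (fromℤ³-· t ℤ[θ].θ z))))
        (triple (≡.sym (fromℤ-+ i z₀)) (≡.sym (fromℤ-+ 0ℤ z₁)) (≡.sym (fromℤ-+ 0ℤ z₂)))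
      where
      θz = ℤ[θ].θ ℤ[θ].· z
      z₀ = proj₁ θz
      z₁ = proj₁ (proj₂ θz)
      z₂ = proj₂ (proj₂ θz)

    ℤ[θ]⇒embℤ : ∀ {x} → ℤ[_] K θ x → ∃[ z ] x ≈ embℤ z
    ℤ[θ]⇒embℤ (p , x≈p) = let (z , eq) = coeffs-integral p
      in z , trans x≈p (trans (eval-coeffs (map (ℚ._/ 1) p)) (emb-cong eq))

    embℤ⇒ℤ[θ] : ∀ {x} z → x ≈ embℤ z → ℤ[_] K θ x
    embℤ⇒ℤ[θ] (a , b , c) x≈z = a ∷ b ∷ c ∷ [] , trans x≈z
      (trans (solve 4 (λ θ a b c → a :+ b :* θ :+ c :* (θ :* θ) :=
        a :+ θ :* (b :+ θ :* (c :+ θ :* con 0ℚ))) refl θ _ _ _)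
        (+-congˡ (*-congˡ (+-congˡ (*-congˡ (+-congˡ (*-congˡ 0#-homo)))))))
      where open KSolver

    -- A denominator apart from 0 has nonzero coordinates, hence an inverse within the span of
    -- `1, θ, θ²`. This span therefore contains all fractions.
    coordinates : (∀ x → ℚ⟨_⟩ K θ x) → ∀ x → ∃[ y ] x ≈ emb y
    coordinates generates x =
      let (f , g , g#0 , xg≈f) = generates x
          g≢0 = λ eq → #-irrefl (trans (eval-coeffs g) (trans (emb-cong eq) emb-zero)) g#0
          (y , gy≈1) = emb-invertible g≢0
      in coeffs f ℚ[θ].· y , (begin
        x                              ≈⟨ *-identityʳ x ⟨
        x * 1#                         ≈⟨ *-congˡ gy≈1 ⟨
        x * (emb (coeffs g) * emb y)   ≈⟨ *-assoc _ _ _ ⟨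
        x * emb (coeffs g) * emb y     ≈⟨ *-congʳ (trans (*-congˡ (sym (eval-coeffs g)))
          (trans xg≈f (eval-coeffs f))) ⟩
        emb (coeffs f) * emb y         ≈⟨ emb-· (coeffs f) y ⟨
        emb (coeffs f ℚ[θ].· y)        ∎)
      where open ≈-Reasoning

    module Coordinates (κ : Carrier → ℚ³) (κ-spec : ∀ x → x ≈ emb (κ x)) where

      κ-unique : ∀ {x} y → x ≈ emb y → κ x ≡ y
      κ-unique {x} y x≈y = emb-injective (trans (sym (κ-spec x)) x≈y)

      κ-cong : ∀ {x y} → x ≈ y → κ x ≡ κ y
      κ-cong {x} {y} x≈y = κ-unique (κ y) (trans x≈y (κ-spec y))

      κ-+ : ∀ x y → κ (x + y) ≡ κ x ⊞ κ y
      κ-+ x y = κ-unique (κ x ⊞ κ y) (trans (+-cong (κ-spec x) (κ-spec y))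
        (sym (emb-⊞ (κ x) (κ y))))

      κ-ι* : ∀ q x → κ (ι q * x) ≡ q • κ x
      κ-ι* q x = κ-unique (q • κ x) (trans (*-congˡ (κ-spec x)) (sym (emb-• q (κ x))))

      κ-* : ∀ x y → κ (x * y) ≡ κ x ℚ[θ].· κ y
      κ-* x y = κ-unique (κ x ℚ[θ].· κ y) (trans (*-cong (κ-spec x) (κ-spec y))
        (sym (emb-· (κ x) (κ y))))

      component-linear : (π : ℚ³ → ℚ) → (∀ x y → π (x ⊞ y) ≡ π x ℚ.+ π y) →
        (∀ q x → π (q • x) ≡ q ℚ.* π x) →
        IsLinear (λ x → π (κ x))
      component-linear π π-⊞ π-• .φ-cong x≈y = ≡.cong π (κ-cong x≈y)
      component-linear π π-⊞ π-• .φ-+ x y = ≡.trans (≡.cong π (κ-+ x y)) (π-⊞ (κ x) (κ y))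
      component-linear π π-⊞ π-• .φ-ι q x = ≡.trans (≡.cong π (κ-ι* q x)) (π-• q (κ x))

      -- The trace, defined by the given basis, is moved to `1, θ, θ²`; there the diagonal of the
      -- multiplication matrix is linear in the coordinates of `x`.
      Tr-κ : ∀ x → Tr K x ≡ ℚ[θ].⟨ ℚ[θ].traces ∣ κ x ⟩
      Tr-κ x = ≡.trans
        (Tr-change-of-basis (λ x → proj₁ (κ x)) (λ x → proj₁ (proj₂ (κ x)))
          (λ x → proj₂ (proj₂ (κ x))) 1# θ (θ * θ)
          (component-linear proj₁ (λ _ _ → ≡.refl) (λ _ _ → ≡.refl))
          (component-linear (λ x → proj₁ (proj₂ x)) (λ _ _ → ≡.refl) (λ _ _ → ≡.refl))
          (component-linear (λ x → proj₂ (proj₂ x)) (λ _ _ → ≡.refl) (λ _ _ → ≡.refl))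
          (λ x → trans (κ-spec x) (+-congʳ (+-congʳ (sym (*-identityʳ _)))))
          x)
        (≡.trans (≡.cong₂ ℚ._+_ (≡.cong₂ ℚ._+_
            (≡.cong proj₁ (κ-cong (*-identityʳ x)))
            (≡.cong (λ y → proj₁ (proj₂ y))
              (≡.trans (κ-* x θ) (≡.cong (κ x ℚ[θ].·_) (κ-unique ℚ[θ].θ (sym emb-θ))))))
            (≡.cong (λ y → proj₂ (proj₂ y))
              (≡.trans (κ-* x (θ * θ)) (≡.cong (κ x ℚ[θ].·_) (κ-unique ℚ[θ].θ² (sym emb-θ²))))))
          (matrix-trace (κ x)))
        where
        matrix-trace : ∀ y → proj₁ y ℚ.+ proj₁ (proj₂ (y ℚ[θ].· ℚ[θ].θ)) ℚ.+ proj₂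
          (proj₂ (y ℚ[θ].· ℚ[θ].θ²)) ≡ ℚ[θ].⟨ ℚ[θ].traces ∣ y ⟩
        matrix-trace (a , b , c) = prove (fromℤ t ∷ a ∷ b ∷ c ∷ [])
          (var 1F :+ proj₁ (proj₂ (Y P.· P.θ)) :+ proj₂ (proj₂ (Y P.· P.θ²))) P.⟨ P.traces ∣ Y ⟩
            ≡.refl
          where
          open ℚSolver.+-*-Solver
          module P = CubicOrder {A = Polynomial 4} _:+_ _:*_ :-_ (con 0ℚ) (con 1ℚ) (var 0F)
          Y : P.Triple
          Y = var 1F , var 2F , var 3F

-- Null sequences and bounded sequences

module RealRoots where

  open import Algebra.Bundles using (CommutativeRing)
  open import Data.Fin.Base using (suc)
  open Rationals
  open NumberFields using (module Q; _⊞_)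
  open import Data.Fin.Patterns
  open import Data.Integer.Base as ℤ using (ℤ; +_; 0ℤ; 1ℤ)
  import Data.Integer.Properties as ℤₚ
  import Data.Nat.Base as ℕ
  import Data.Nat.Properties as ℕₚ
  open ℕ using (ℕ)
  open import Data.Product.Base using (_×_; _,_; ∃-syntax)
  open import Data.Rational.Base
  open import Data.Rational.Properties
  open import Data.Rational.Solver
  open import Data.Sum.Base using (inj₁; inj₂)
  open import Data.Vec.Base using (Vec; _∷_; []; lookup)
  open import Algebra.Properties.Semiring.Exp (CommutativeRing.semiring +-*-commutativeRing) using (_^_)
  open import Relation.Binary.PropositionalEquality
  open import Relation.Nullary using (yes; no; contradiction)
  open Reals using (Eventually; Cauchy)

  -- Equality of reals is nullity of the termwise difference, so identities between reals become
  -- statements about rational sequences.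
  Null : (ℕ → ℚ) → Set
  Null s = ∀ ε → 0ℚ < ε → Eventually (λ n → ∣ s n ∣ < ε)

  Bounded : (ℕ → ℚ) → Set
  Bounded s = ∃[ B ] (0ℚ < B × (∀ n → ∣ s n ∣ ≤ B))

  0≤* : ∀ {p q} → 0ℚ ≤ p → 0ℚ ≤ q → 0ℚ ≤ p * q
  0≤* {p} {q} 0≤p 0≤q = nonNegative⁻¹ (p * q)
    {{nonNeg*nonNeg⇒nonNeg p {{nonNegative 0≤p}} q {{nonNegative 0≤q}}}}

  x≤x+y : ∀ {x y} → 0ℚ ≤ y → x ≤ x + y
  x≤x+y {x} {y} 0≤y = subst (_≤ x + y) (+-identityʳ x) (+-monoʳ-≤ x 0≤y)

  0<½ : 0ℚ < ½
  0<½ = positive⁻¹ ½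

  ∣p∣≤ : ∀ {p b} → - b ≤ p → p ≤ b → ∣ p ∣ ≤ b
  ∣p∣≤ {p} {b} -b≤p p≤b with ∣p∣≡p∨∣p∣≡-p p
  ... | inj₁ eq = subst (_≤ b) (sym eq) p≤b
  ... | inj₂ eq = subst₂ _≤_ (sym eq) (neg-involutive b) (neg-antimono-≤ -b≤p)
    where
    neg-involutive : ∀ b → - (- b) ≡ b
    neg-involutive = solve 1 (λ b → :- (:- b) := b) refl
      where open +-*-Solver

  0≤x*x : ∀ x → 0ℚ ≤ x * x
  0≤x*x x with ∣p∣≡p∨∣p∣≡-p x
  ... | inj₁ eq = subst (λ y → 0ℚ ≤ y * y) eq (0≤* (0≤∣p∣ x) (0≤∣p∣ x))
  ... | inj₂ eq = subst (0ℚ ≤_) (trans (cong₂ _*_ eq eq) (solve 1 (λ x → (:- x) :* (:- x) := x :* x)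
    refl x)) (0≤* (0≤∣p∣ x) (0≤∣p∣ x))
    where open +-*-Solver

  eventually-∧ : ∀ {P Q R : ℕ → Set} → (∀ {n} → P n → Q n → R n) → Eventually P → Eventually Q →
    Eventually R
  eventually-∧ f (N , p) (M , q) = N ℕ.⊔ M , λ n le → f (p n (ℕₚ.m⊔n≤o⇒m≤o N M le))
    (q n (ℕₚ.m⊔n≤o⇒n≤o N M le))

  null-mono : ∀ {s s′} → (∀ n → ∣ s n ∣ ≤ ∣ s′ n ∣) → Null s′ → Null s
  null-mono le null ε 0<ε = let (N , h) = null ε 0<ε in N , λ n N≤n → ≤-<-trans (le n) (h n N≤n)

  null-cong : ∀ {s s′} → (∀ n → s n ≡ s′ n) → Null s′ → Null s
  null-cong eq = null-mono (λ n → ≤-reflexive (cong ∣_∣ (eq n)))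

  null-0 : ∀ {s} → (∀ n → s n ≡ 0ℚ) → Null s
  null-0 eq ε 0<ε = 0 , λ n _ → subst (λ x → ∣ x ∣ < ε) (sym (eq n)) 0<ε

  null-+ : ∀ {s s′} → Null s → Null s′ → Null (λ n → s n + s′ n)
  null-+ {s} {s′} p q ε 0<ε = eventually-∧
    (λ {n} a b → ≤-<-trans (∣p+q∣≤∣p∣+∣q∣ (s n) (s′ n)) (subst (∣ s n ∣ + ∣ s′ n ∣ <_) half+half
      (+-mono-< a b)))
    (p (ε * ½) (0<* 0<ε 0<½)) (q (ε * ½) (0<* 0<ε 0<½))
    where
    half+half : ε * ½ + ε * ½ ≡ ε
    half+half = solve 1 (λ ε → ε :* con ½ :+ ε :* con ½ := ε) refl ε
      where open +-*-Solver

  null-* : ∀ {b s} → Bounded b → Null s → Null (λ n → b n * s n)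
  null-* {b} {s} (B , 0<B , b≤B) null ε 0<ε =
    let (N , h) = null (ε * 1/ B) (0<* 0<ε (positive⁻¹ (1/ B) {{1/pos⇒pos B}}))
    in N , λ n N≤n → begin-strict
      ∣ b n * s n ∣      ≡⟨ ∣p*q∣≡∣p∣*∣q∣ (b n) (s n) ⟩
      ∣ b n ∣ * ∣ s n ∣  ≤⟨ *-monoʳ-≤-nonNeg ∣ s n ∣ {{∣-∣-nonNeg (s n)}} (b≤B n) ⟩
      B * ∣ s n ∣        <⟨ *-monoʳ-<-pos B (h n N≤n) ⟩
      B * (ε * 1/ B)     ≡⟨ solve 3 (λ B ε i → B :* (ε :* i) := ε :* (B :* i)) refl B ε (1/ B) ⟩
      ε * (B * 1/ B)     ≡⟨ cong (ε *_) (*-inverseʳ B) ⟩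
      ε * 1ℚ             ≡⟨ *-identityʳ ε ⟩
      ε                  ∎
    where
    open ≤-Reasoning
    open +-*-Solver
    instance
      B-pos : Positive B
      B-pos = positive 0<B
      B-nz : NonZero B
      B-nz = pos⇒nonZero B

  -- A negative `q` would keep distance at least `- q` from every nonnegative term.
  0≤limit : ∀ {q} {s : ℕ → ℚ} → Eventually (λ n → 0ℚ ≤ s n) → Null (λ n → q - s n) → 0ℚ ≤ q
  0≤limit {q} {s} (M , s≥0) null with 0ℚ ≤? q
  ... | yes 0≤q = 0≤q
  ... | no  q<0 =
    let (N , h) = null (- q) (neg-antimono-< (≰⇒> q<0))
        n = N ℕ.⊔ M
    in contradiction (≤-<-trans (large n (s≥0 n (ℕₚ.m≤n⊔m N M))) (h n (ℕₚ.m≤m⊔n N M)))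
      (<-irrefl refl)
    where
    large : ∀ n → 0ℚ ≤ s n → - q ≤ ∣ q - s n ∣
    large n 0≤s with ∣p∣≡p∨∣p∣≡-p (q - s n)
    ... | inj₂ eq = subst (- q ≤_) (trans (solve 2 (λ q s → :- q :+ s := :- (q :- s)) refl q (s n))
      (sym eq)) (x≤x+y 0≤s)
      where open +-*-Solver
    ... | inj₁ eq = contradiction (≤-<-trans (0≤∣p∣ (q - s n))
      (≤-<-trans (subst₂ _≤_ (sym eq) (+-identityʳ q) (+-monoʳ-≤ q (neg-antimono-≤ 0≤s)))
      (≰⇒> q<0))) (<-irrefl refl)

  bounded-const : ∀ q → Bounded (λ _ → q)
  bounded-const q = 1ℚ + ∣ q ∣ , +-mono-<-≤ (positive⁻¹ 1ℚ) (0≤∣p∣ q) ,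
    λ _ → subst (_≤ 1ℚ + ∣ q ∣) (+-identityˡ ∣ q ∣) (+-monoˡ-≤ ∣ q ∣ (<⇒≤ (positive⁻¹ 1ℚ)))

  bounded-+ : ∀ {s s′} → Bounded s → Bounded s′ → Bounded (λ n → s n + s′ n)
  bounded-+ {s} {s′} (B , 0<B , h) (B′ , 0<B′ , h′) = B + B′ , +-mono-< 0<B 0<B′ ,
    λ n → ≤-trans (∣p+q∣≤∣p∣+∣q∣ (s n) (s′ n)) (+-mono-≤ (h n) (h′ n))

  bounded-* : ∀ {s s′} → Bounded s → Bounded s′ → Bounded (λ n → s n * s′ n)
  bounded-* {s} {s′} (B , 0<B , h) (B′ , 0<B′ , h′) = B * B′ , 0<* 0<B 0<B′ , λ n → begin
    ∣ s n * s′ n ∣      ≡⟨ ∣p*q∣≡∣p∣*∣q∣ (s n) (s′ n) ⟩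
    ∣ s n ∣ * ∣ s′ n ∣  ≤⟨ *-monoʳ-≤-nonNeg ∣ s′ n ∣ {{∣-∣-nonNeg (s′ n)}} (h n) ⟩
    B * ∣ s′ n ∣        ≤⟨ *-monoˡ-≤-nonNeg B {{pos⇒nonNeg B {{positive 0<B}}}} (h′ n) ⟩
    B * B′              ∎
    where open ≤-Reasoning

  bounded-neg : ∀ {s} → Bounded s → Bounded (λ n → - s n)
  bounded-neg {s} (B , 0<B , h) = B , 0<B , λ n → subst (_≤ B) (sym (∣-p∣≡∣p∣ (s n))) (h n)

  bounded-^ : ∀ {s} → Bounded s → ∀ k → Bounded (λ n → s n ^ k)
  bounded-^ bs ℕ.zero            = bounded-const 1ℚ
  bounded-^ {s} bs (ℕ.suc k) = bounded-* {s} {λ n → s n ^ k} bs (bounded-^ {s} bs k)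

  module _ where
    open +-*-Solver

    -- Stated for solver syntax, so that the same expression can be the cofactor in an identity and
    -- be estimated.
    bounded-⟦⟧ : ∀ {m} (f : Polynomial m) (env : ℕ → Vec ℚ m) →
      (∀ i → Bounded (λ n → lookup (env n) i)) →
                 Bounded (λ n → ⟦ f ⟧ (env n))
    bounded-⟦⟧ (op [+] f g) env h = bounded-+ {λ n → ⟦ f ⟧ (env n)} {λ n → ⟦ g ⟧ (env n)}
      (bounded-⟦⟧ f env h) (bounded-⟦⟧ g env h)
    bounded-⟦⟧ (op [*] f g) env h = bounded-* {λ n → ⟦ f ⟧ (env n)} {λ n → ⟦ g ⟧ (env n)}
      (bounded-⟦⟧ f env h) (bounded-⟦⟧ g env h)
    bounded-⟦⟧ (con q)      env h = bounded-const q
    bounded-⟦⟧ (var i)      env h = h i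
    bounded-⟦⟧ (f :^ k)     env h = bounded-^ {λ n → ⟦ f ⟧ (env n)} (bounded-⟦⟧ f env h) k
    bounded-⟦⟧ (:- f)       env h = bounded-neg {λ n → ⟦ f ⟧ (env n)} (bounded-⟦⟧ f env h)

  width : ℕ → ℚ
  width ℕ.zero    = 1ℚ
  width (ℕ.suc n) = width n * ½

  0≤width : ∀ n → 0ℚ ≤ width n
  0≤width ℕ.zero    = <⇒≤ (positive⁻¹ 1ℚ)
  0≤width (ℕ.suc n) = 0≤* (0≤width n) (<⇒≤ 0<½)

  width-halves : ∀ n → width (ℕ.suc n) + width (ℕ.suc n) ≡ width n
  width-halves n = solve 1 (λ w → w :* con ½ :+ w :* con ½ := w) refl (width n)
    where open +-*-Solver

  -- The estimate `2⁻ⁿ ≤ 1/(n+1)` makes the denominator of `ε` an explicit index from which on the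
  -- width is below `ε`.
  width*[1+n]≤1 : ∀ n → width n * fromℤ (+ ℕ.suc n) ≤ 1ℚ
  width*[1+n]≤1 ℕ.zero    = ≤-refl
  width*[1+n]≤1 (ℕ.suc n) = begin
    width n * ½ * fromℤ (+ ℕ.suc (ℕ.suc n))             ≡⟨ *-assoc (width n) ½ _ ⟩
    width n * (½ * fromℤ (+ ℕ.suc (ℕ.suc n)))           ≤⟨ *-monoˡ-≤-nonNeg (width n)
      {{nonNegative (0≤width n)}} halve ⟩
    width n * fromℤ (+ ℕ.suc n)                         ≤⟨ width*[1+n]≤1 n ⟩
    1ℚ                                                  ∎
    where
    open ≤-Reasoning
    open +-*-Solver
    N = fromℤ (+ ℕ.suc n)
    halve : ½ * fromℤ (+ ℕ.suc (ℕ.suc n)) ≤ N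
    halve = begin
      ½ * fromℤ (+ ℕ.suc (ℕ.suc n)) ≤⟨ *-monoˡ-≤-nonNeg ½
        (fromℤ-mono-≤ (ℤ.+≤+ (ℕ.s≤s (ℕₚ.m≤n+m (ℕ.suc n) n)))) ⟩
      ½ * fromℤ (+ ℕ.suc n ℤ.+ + ℕ.suc n) ≡⟨ cong (½ *_) (fromℤ-+ (+ ℕ.suc n) (+ ℕ.suc n)) ⟩
      ½ * (N + N)                   ≡⟨ solve 1 (λ x → con ½ :* (x :+ x) := x) refl N ⟩
      N                             ∎

  1≤ε*denominator : ∀ ε → 0ℚ < ε → 1ℚ ≤ ε * fromℤ (↧ ε)
  1≤ε*denominator ε@record{} (*<* p) = subst (1ℚ ≤_) (sym (*-denominator ε))
    (fromℤ-mono-≤ {1ℤ} (ℤₚ.i<j⇒suc[i]≤j (subst₂ ℤ._<_ (ℤₚ.*-zeroˡ (↧ ε)) (ℤₚ.*-identityʳ (↥ ε)) p)))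

  null-width : Null width
  null-width ε 0<ε = ↧ₙ ε , λ n d≤n → subst (_< ε) (sym (0≤p⇒∣p∣≡p (0≤width n)))
    (*-cancelʳ-<-nonNeg (fromℤ (+ ℕ.suc n))
      {{nonNegative (fromℤ-mono-≤ {0ℤ} {+ ℕ.suc n} (ℤ.+≤+ ℕ.z≤n))}} (begin-strict
      width n * fromℤ (+ ℕ.suc n)  ≤⟨ width*[1+n]≤1 n ⟩
      1ℚ                           ≤⟨ 1≤ε*denominator ε 0<ε ⟩
      ε * fromℤ (↧ ε)              ≡⟨ +-identityʳ _ ⟨
      ε * fromℤ (↧ ε) + 0ℚ         <⟨ +-monoʳ-< (ε * fromℤ (↧ ε)) 0<ε ⟩
      ε * fromℤ (↧ ε) + ε          ≡⟨ solve 2 (λ ε d → ε :* d :+ ε := ε :* (con 1ℚ :+ d)) refl ε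
        (fromℤ (↧ ε)) ⟩
      ε * (1ℚ + fromℤ (↧ ε))       ≡⟨ cong (ε *_) (fromℤ-+ 1ℤ (↧ ε)) ⟨
      ε * fromℤ (1ℤ ℤ.+ ↧ ε)       ≤⟨ *-monoˡ-≤-nonNeg ε {{nonNegative (<⇒≤ 0<ε)}}
        (fromℤ-mono-≤ {1ℤ ℤ.+ ↧ ε} (ℤₚ.+-monoʳ-≤ 1ℤ (ℤ.+≤+ d≤n))) ⟩
      ε * fromℤ (+ ℕ.suc n)        ∎))
    where
    open ≤-Reasoning
    open +-*-Solver

  -- The three real roots and the embeddings they define

  module Roots (t : ℤ) where
    open Q t using (e; _·_; sq; traces; ⟨_∣_⟩)
    private
      T = fromℤ t
      module S = +-*-Solver
      module P {n} = CubicOrder {A = S.Polynomial (2 ℕ.+ n)} S._:+_ S._:*_ S.:-_ (S.con 0ℚ) (S.con 1ℚ) (S.var 1F)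

    p : ℚ → ℚ
    p x = x * x * x - T * x * x - e * x - 1ℚ

    pP : ∀ {n} → S.Polynomial (2 ℕ.+ n) → S.Polynomial (2 ℕ.+ n)
    pP x = x :* x :* x :- var 1F :* x :* x :- P.e :* x :- con 1ℚ
      where open S

    bounded-env : ∀ {m} {r} (cs : Vec ℚ m) → Bounded r → ∀ i →
      Bounded (λ n → lookup (r n ∷ T ∷ cs) i)
    bounded-env cs br 0F      = br
    bounded-env cs br (suc i) = bounded-const (lookup (T ∷ cs) i)

    -- Calculation modulo the cubic at an approximate root: a multiple `k p` tends to 0 along `r`
    -- since `k` stays bounded and `p` tends to 0. The cofactor `k` is the certificate checked by
    -- the solver.
    null-multiple : ∀ {m} {r} (cs : Vec ℚ m) → Bounded r → Null (λ n → p (r n)) →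
      (f k : S.Polynomial (2 ℕ.+ m)) →
      (∀ n → S.⟦ f ⟧↓ (r n ∷ T ∷ cs) ≡ S.⟦ k S.:* pP (S.var 0F) ⟧↓ (r n ∷ T ∷ cs)) →
      Null (λ n → S.⟦ f ⟧ (r n ∷ T ∷ cs))
    null-multiple {r = r} cs br null-p f k eq = null-cong
      (λ n → S.prove (r n ∷ T ∷ cs) f (k S.:* pP (S.var 0F)) (eq n))
      (null-* {λ n → S.⟦ k ⟧ (r n ∷ T ∷ cs)} {λ n → p (r n)} (bounded-⟦⟧ k (λ n → r n ∷ T ∷ cs)
        (bounded-env cs br)) null-p)

    -- p (-1) = 1 and p 0 = -1, so bisection of [-1 , 0] finds a root.
    lower : ℕ → ℚ
    lower ℕ.zero    = - 1ℚ
    lower (ℕ.suc n) with 0ℚ ≤? p (lower n + width (ℕ.suc n))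
    ... | yes _ = lower n + width (ℕ.suc n)
    ... | no  _ = lower n

    upper : ℕ → ℚ
    upper n = lower n + width n

    p-lower≥0 : ∀ n → 0ℚ ≤ p (lower n)
    p-lower≥0 ℕ.zero = subst (0ℚ ≤_) (S.prove (0ℚ ∷ T ∷ []) (S.con 1ℚ) (pP (S.con (- 1ℚ))) refl)
      (<⇒≤ (positive⁻¹ 1ℚ))
    p-lower≥0 (ℕ.suc n) with 0ℚ ≤? p (lower n + width (ℕ.suc n))
    ... | yes q = q
    ... | no  _ = p-lower≥0 n

    lower+halves : ∀ n → lower n + width (ℕ.suc n) + width (ℕ.suc n) ≡ upper n
    lower+halves n = trans (+-assoc (lower n) _ _) (cong (λ w → lower n + w) (width-halves n))

    p-upper≤0 : ∀ n → p (upper n) ≤ 0ℚ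
    p-upper≤0 ℕ.zero = subst (_≤ 0ℚ) (S.prove (0ℚ ∷ T ∷ []) (S.con (- 1ℚ)) (pP (S.con 0ℚ)) refl)
      (<⇒≤ (negative⁻¹ (- 1ℚ)))
    p-upper≤0 (ℕ.suc n) with 0ℚ ≤? p (lower n + width (ℕ.suc n))
    ... | yes _ = subst (λ x → p x ≤ 0ℚ) (sym (lower+halves n)) (p-upper≤0 n)
    ... | no  q = <⇒≤ (≰⇒> q)

    lower-step : ∀ n → lower n ≤ lower (ℕ.suc n)
    lower-step n with 0ℚ ≤? p (lower n + width (ℕ.suc n))
    ... | yes _ = x≤x+y (0≤width (ℕ.suc n))
    ... | no  _ = ≤-refl

    upper-step : ∀ n → upper (ℕ.suc n) ≤ upper n
    upper-step n with 0ℚ ≤? p (lower n + width (ℕ.suc n))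
    ... | yes _ = ≤-reflexive (lower+halves n)
    ... | no  _ = subst (lower n + width (ℕ.suc n) ≤_) (lower+halves n) (x≤x+y (0≤width (ℕ.suc n)))

    nested : ∀ {m n} → m ℕ.≤′ n → lower m ≤ lower n × lower n ≤ upper m
    nested {m} {n} m≤n = let (a , b) = go m≤n in a , ≤-trans (x≤x+y (0≤width n)) b
      where
      go : ∀ {n} → m ℕ.≤′ n → lower m ≤ lower n × upper n ≤ upper m
      go ℕ.≤′-refl = ≤-refl , ≤-refl
      go (ℕ.≤′-step {n} m≤n) = let (a , b) = go m≤n in ≤-trans a (lower-step n) ,
                                     ≤-trans (upper-step n) b

    lower-cauchy : Cauchy lower
    lower-cauchy ε 0<ε = let (N , h) = null-width ε 0<ε in N , λ m n N≤m N≤n →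
      let (a , b) = nested (ℕₚ.≤⇒≤′ N≤m)
          (a′ , b′) = nested (ℕₚ.≤⇒≤′ N≤n)
      in ≤-<-trans (∣p∣≤ (close a b′) (close′ b a′)) (subst (_< ε) (0≤p⇒∣p∣≡p (0≤width N))
        (h N ℕₚ.≤-refl))
      where
      open +-*-Solver
      close′ : ∀ {l w x y} → x ≤ l + w → l ≤ y → x - y ≤ w
      close′ {l} {w} {x} {y} p q = subst (x - y ≤_) (solve 2 (λ l w → l :+ w :- l := w) refl l w)
        (+-mono-≤ p (neg-antimono-≤ q))
      close : ∀ {l w x y} → l ≤ x → y ≤ l + w → - w ≤ x - y
      close {l} {w} {x} {y} p q = subst (_≤ x - y) (solve 2 (λ l w → l :- (l :+ w) := :- w) refl l
        w) (+-mono-≤ p (neg-antimono-≤ q))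

    bounded-lower : Bounded lower
    bounded-lower = 1ℚ , positive⁻¹ 1ℚ , λ n → let (a , b) = nested (ℕₚ.≤⇒≤′ (ℕ.z≤n {n})) in
      ∣p∣≤ a (≤-trans b (<⇒≤ (positive⁻¹ 1ℚ)))

    bounded-width : Bounded width
    bounded-width = 1ℚ , positive⁻¹ 1ℚ , λ n → subst (_≤ 1ℚ) (sym (0≤p⇒∣p∣≡p (0≤width n)))
      (width≤1 n)
      where
      width≤1 : ∀ n → width n ≤ 1ℚ
      width≤1 ℕ.zero = ≤-refl
      width≤1 (ℕ.suc n) = ≤-trans (subst (width (ℕ.suc n) ≤_) (width-halves n)
        (x≤x+y (0≤width (ℕ.suc n)))) (width≤1 n)

    -- As `p` is nonnegative at `lower n` and nonpositive at `upper n`, its value at `lower n` is at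
    -- most the difference of the two, which is the width times a difference quotient; that quotient
    -- is a polynomial in bounded sequences.
    null-p-lower : Null (λ n → p (lower n))
    null-p-lower = null-mono bound (null-* {slope} {width} bounded-slope null-width)
      where
      open +-*-Solver
      slopeP : Polynomial 3
      slopeP = var 1F :* (l :+ l :+ w) :+ P.e :- (l :* l :+ l :* (l :+ w) :+ (l :+ w) :* (l :+ w))
        where
        l w : Polynomial 3
        l = var 0F
        w = var 2F
      slope : ℕ → ℚ
      slope n = ⟦ slopeP ⟧ (lower n ∷ T ∷ width n ∷ [])
      bounded-slope : Bounded slope
      bounded-slope = bounded-⟦⟧ slopeP (λ n → lower n ∷ T ∷ width n ∷ []) λ
        { 0F → bounded-lower ; 1F → bounded-const T ; 2F → bounded-width }
      bound : ∀ n → ∣ p (lower n) ∣ ≤ ∣ slope n * width n ∣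
      bound n = begin
        ∣ p (lower n) ∣ ≡⟨ 0≤p⇒∣p∣≡p (p-lower≥0 n) ⟩
        p (lower n) ≤⟨ x≤x+y (neg-antimono-≤ (p-upper≤0 n)) ⟩
        p (lower n) - p (upper n) ≡⟨ prove (lower n ∷ T ∷ width n ∷ [])
          (pP (var 0F) :- pP (var 0F :+ var 2F)) (slopeP :* var 2F) refl ⟩
        slope n * width n ≤⟨ p≤∣p∣ (slope n * width n) ⟩
        ∣ slope n * width n ∣ ∎
        where
        open ≤-Reasoning
        p≤∣p∣ : ∀ x → x ≤ ∣ x ∣
        p≤∣p∣ x with ∣p∣≡p∨∣p∣≡-p x
        ... | inj₁ eq = ≤-reflexive (sym eq)
        ... | inj₂ eq with 0ℚ ≤? x
        ...   | yes 0≤x = ≤-reflexive (sym (0≤p⇒∣p∣≡p 0≤x))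
        ...   | no  x<0 = ≤-trans (<⇒≤ (≰⇒> x<0)) (0≤∣p∣ x)

    record Root : Set where
      field
        ρ         : ℝ
        null-p    : Null (λ n → p (seq ρ n))
        bounded-ρ : Bounded (seq ρ)

    root₁ : Root
    root₁ = record { ρ = mkℝ lower lower-cauchy ; null-p = null-p-lower ; bounded-ρ =
      bounded-lower }

    private
      r : ℝ
      r = Root.ρ root₁
      -- Inverses modulo the cubic are polynomials, so no real division occurs. The reals `ρ` below
      -- repeat these expressions term by term, and their sequences are the evaluations of `conj₂`
      -- and `conj₃`.
      conj₂ conj₃ : ∀ {n} → S.Polynomial (2 ℕ.+ n)
      conj₂ = x :* x :+ :- (var 1F :+ con 1ℚ) :* x :+ :- (con 1ℚ :+ con 1ℚ)
        where
        open S
        x = var 0F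
      conj₃ = :- (x :* x) :+ var 1F :* x :+ (var 1F :+ (con 1ℚ :+ con 1ℚ))
        where
        open S
        x = var 0F

    -- The Galois conjugates -1/(1 + r) and -(1 + r)/r of r.
    root₂ root₃ : Root
    root₂ = record
      { ρ         = r *ᵣ r +ᵣ -ᵣ (fromℚ T +ᵣ fromℚ 1ℚ) *ᵣ r +ᵣ -ᵣ (fromℚ 1ℚ +ᵣ fromℚ 1ℚ)
      ; null-p    = null-multiple [] bounded-lower null-p-lower (pP conj₂)
          -- The quotient of the cubic evaluated at `conj₂` by the cubic itself.
          (x :* x :* x :+ :- (three :+ (τ :+ τ)) :* (x :* x) :+ (τ :* τ :+ (τ :+ τ :+ τ)) :* x :+
            (three :+ (τ :+ τ))) (λ _ → refl)
      ; bounded-ρ = bounded-⟦⟧ conj₂ (λ n → lower n ∷ T ∷ []) (bounded-env [] bounded-lower)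
      }
      where
      open S
      x τ three : Polynomial 2
      x = var 0F
      τ = var 1F
      three = con 1ℚ :+ con 1ℚ :+ con 1ℚ
    root₃ = record
      { ρ         = -ᵣ (r *ᵣ r) +ᵣ fromℚ T *ᵣ r +ᵣ (fromℚ T +ᵣ (fromℚ 1ℚ +ᵣ fromℚ 1ℚ))
      ; null-p    = null-multiple [] bounded-lower null-p-lower (pP conj₃)
          (:- (x :* x :* x) :+ (τ :+ τ) :* (x :* x) :+ (P.e :- τ :* τ) :* x :+ :-
            (τ :* τ :+ (τ :+ τ :+ τ) :+ con 1ℚ)) (λ _ → refl)
      ; bounded-ρ = bounded-⟦⟧ conj₃ (λ n → lower n ∷ T ∷ []) (bounded-env [] bounded-lower)
      }
      where
      open S
      x τ : Polynomial 2
      x = var 0F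
      τ = var 1F

    σ : Root → ℚ³ → ℝ
    σ R (a , b , c) = fromℚ a +ᵣ fromℚ b *ᵣ ρ +ᵣ fromℚ c *ᵣ (ρ *ᵣ ρ)
      where open Root R

    module _ (R : Root) where
      open Root R

      private
        evP : ∀ {n} → P.Triple {n} → S.Polynomial (2 ℕ.+ n)
        evP (a , b , c) = a :+ b :* var 0F :+ c :* (var 0F :* var 0F)
          where open S

      bounded-σ : ∀ x → Bounded (seq (σ R x))
      bounded-σ (a , b , c) = bounded-⟦⟧ (evP (S.var 2F , S.var 3F , S.var 4F))
        (λ n → seq ρ n ∷ T ∷ a ∷ b ∷ c ∷ [])
        (bounded-env (a ∷ b ∷ c ∷ []) bounded-ρ)

      -- The cofactor is the quotient found in `K`, with the opposite sign because the reduced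
      -- product stands first.
      σ-· : ∀ x y → σ R (x · y) ≈ᵣ σ R x *ᵣ σ R y
      σ-· (a₀ , a₁ , a₂) (b₀ , b₁ , b₂) = null-multiple (a₀ ∷ a₁ ∷ a₂ ∷ b₀ ∷ b₁ ∷ b₂ ∷ []) bounded-ρ
        null-p
        (evP (X P.· Y) :- evP X :* evP Y)
        (:- (var 3F :* var 7F :+ var 4F :* var 6F :+ var 4F :* var 7F :* (var 1F :+ var 0F)))
          (λ _ → refl)
        where
        open S
        X Y : P.Triple {6}
        X = var 2F , var 3F , var 4F
        Y = var 5F , var 6F , var 7F

      σ-cong : ∀ {x y} → x ≡ y → σ R x ≈ᵣ σ R y
      σ-cong {x} refl = null-0 {λ n → seq (σ R x) n - seq (σ R x) n}
        (λ n → +-inverseʳ (seq (σ R x) n))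

      σ-⊞ : ∀ x y → σ R (x ⊞ y) ≈ᵣ σ R x +ᵣ σ R y
      σ-⊞ x@(a , b , c) y@(a′ , b′ , c′) =
        null-0 {λ n → seq (σ R (x ⊞ y)) n - seq (σ R x +ᵣ σ R y) n} λ n →
        solve 7 (λ a b c a′ b′ c′ ρ → (a :+ a′ :+ (b :+ b′) :* ρ :+ (c :+ c′) :* (ρ :* ρ)) :-
          (a :+ b :* ρ :+ c :* (ρ :* ρ) :+ (a′ :+ b′ :* ρ :+ c′ :* (ρ :* ρ))) := con 0ℚ)
          refl a b c a′ b′ c′ (seq ρ n)
        where open +-*-Solver

      σ-neg : ∀ x → σ R ((- 1ℚ) • x) ≈ᵣ -ᵣ σ R x
      σ-neg x@(a , b , c) = null-0 {λ n → seq (σ R ((- 1ℚ) • x)) n - seq (-ᵣ σ R x) n} λ n →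
        solve 4 (λ a b c ρ → (con (- 1ℚ) :* a :+ con (- 1ℚ) :* b :* ρ :+ con (- 1ℚ) :* c :*
          (ρ :* ρ)) :- (:- (a :+ b :* ρ :+ c :* (ρ :* ρ))) := con 0ℚ)
          refl a b c (seq ρ n)
        where open +-*-Solver

      σ-const : ∀ q → σ R (q , 0ℚ , 0ℚ) ≈ᵣ fromℚ q
      σ-const q = null-0 {λ n → seq (σ R (q , 0ℚ , 0ℚ)) n - q} λ n →
        solve 2 (λ q ρ → q :+ con 0ℚ :* ρ :+ con 0ℚ :* (ρ :* ρ) :- q := con 0ℚ) refl q (seq ρ n)
        where open +-*-Solver

      null-twisted-square : ∀ a x →
        Null (λ n → seq (σ R (a · sq x)) n - seq (σ R a) n * (seq (σ R x) n * seq (σ R x) n))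
      null-twisted-square a x = null-cong split
        (null-+ (σ-· a (sq x)) (null-* {seq (σ R a)} (bounded-σ a) (σ-· x x)))
        where
        open +-*-Solver
        split : ∀ n → seq (σ R (a · sq x)) n - seq (σ R a) n * (seq (σ R x) n * seq (σ R x) n) ≡
          (seq (σ R (a · sq x)) n - seq (σ R a) n * seq (σ R (sq x)) n) + seq (σ R a) n *
            (seq (σ R (sq x)) n - seq (σ R x) n * seq (σ R x) n)
        split n = solve 4 (λ u a v x → u :- a :* (x :* x) := (u :- a :* v) :+ a :* (v :- x :* x))
          refl
          (seq (σ R (a · sq x)) n) (seq (σ R a) n) (seq (σ R (sq x)) n) (seq (σ R x) n)

    -- The three roots sum to `t` identically in the first one. Only the sum of their squares needs
    -- the cubic equation, so the cofactor is proportional to the coordinate at `θ²`.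
    null-trace : ∀ y → Null (λ n → ⟨ traces ∣ y ⟩
      - (seq (σ root₁ y) n + seq (σ root₂ y) n + seq (σ root₃ y) n))
    null-trace (a , b , c) = null-multiple (a ∷ b ∷ c ∷ []) bounded-lower null-p-lower
      (P.⟨ P.traces ∣ var 2F , var 3F , var 4F ⟩ :- (evP (var 0F) :+ evP conj₂ :+ evP conj₃))
      (var 4F :* (τ :+ τ :+ two :+ :- two :* var 0F)) (λ _ → refl)
      where
      open S
      τ two : Polynomial 5
      τ = var 1F
      two = con 1ℚ :+ con 1ℚ
      evP : Polynomial 5 → Polynomial 5
      evP x = var 2F :+ var 3F :* x :+ var 4F :* (x :* x)

    -- The trace is a single rational, approached by the sums of three terms. Each term is
    -- eventually nonnegative, because positivity of a real provides a positive rational lower bound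
    -- on its tail.
    trace-twisted-square≥0 : ∀ a → (∀ R → fromℚ 0ℚ <ᵣ σ R a) → ∀ x → 0ℚ ≤ ⟨ traces ∣ a · sq x ⟩
    trace-twisted-square≥0 a a>0 x = 0≤limit {s = total} total≥0 (null-cong split
        (null-+ (null-+ (null-+ (null-trace (a · sq x)) (null-twisted-square root₁ a x))
          (null-twisted-square root₂ a x)) (null-twisted-square root₃ a x)))
      where
      term : Root → ℕ → ℚ
      term R n = seq (σ R a) n * (seq (σ R x) n * seq (σ R x) n)
      total : ℕ → ℚ
      total n = term root₁ n + term root₂ n + term root₃ n
      term≥0 : ∀ R → Eventually (λ n → 0ℚ ≤ term R n)
      term≥0 R = let (ε , 0<ε , N , h) = a>0 R in
        N , λ n N≤n → 0≤* (<⇒≤ (<-trans 0<ε (subst (ε <_) (+-identityʳ (seq (σ R a) n)) (h n N≤n))))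
          (0≤x*x (seq (σ R x) n))
      total≥0 : Eventually (λ n → 0ℚ ≤ total n)
      total≥0 = eventually-∧ {Q = λ n → 0ℚ ≤ term root₃ n} +-mono-≤
        (eventually-∧ {P = λ n → 0ℚ ≤ term root₁ n} {Q = λ n → 0ℚ ≤ term root₂ n} +-mono-≤
        (term≥0 root₁) (term≥0 root₂)) (term≥0 root₃)
      s₁ s₂ s₃ : ℕ → ℚ
      s₁ = seq (σ root₁ (a · sq x))
      s₂ = seq (σ root₂ (a · sq x))
      s₃ = seq (σ root₃ (a · sq x))
      split : ∀ n → ⟨ traces ∣ a · sq x ⟩ - total n ≡
        (⟨ traces ∣ a · sq x ⟩ - (s₁ n + s₂ n + s₃ n)) + (s₁ n - term root₁ n) +
          (s₂ n - term root₂ n) + (s₃ n - term root₃ n)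
      split n = solve 7 (λ q s₁ s₂ s₃ t₁ t₂ t₃ → q :- (t₁ :+ t₂ :+ t₃) := (q :- (s₁ :+ s₂ :+ s₃)) :+
        (s₁ :- t₁) :+ (s₂ :- t₂) :+ (s₃ :- t₃))
        refl ⟨ traces ∣ a · sq x ⟩ (s₁ n) (s₂ n) (s₃ n) (term root₁ n) (term root₂ n) (term root₃ n)
        where open +-*-Solver

-- From integer forms back to traces on `K`

module Conclusion where

  open Identities using (module Z)
  open Rationals
  open NumberFields
  open PowerBases using (module PowerBasis)
  open RealRoots using (module Roots)
  open import Algebra.Morphism.Structures using (IsRingHomomorphism)
  open import Data.Fin.Patterns
  open import Data.Integer.Base as ℤ using (ℤ; +_; -1ℤ; _≤_)
  import Data.Integer.Properties as ℤₚ
  import Data.Nat.Base as ℕ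
  import Data.Nat.Properties as ℕₚ
  open import Data.Product.Base using (_×_; _,_; proj₁; proj₂; ∃-syntax)
  open import Data.Rational.Base as ℚ using (ℚ; 0ℚ; 1ℚ)
  import Data.Rational.Properties as ℚₚ
  import Data.Rational.Solver as ℚSolver
  open import Data.Vec.Base using (_∷_; [])
  open import Function.Bundles using (_⇔_; Equivalence)
  open import Relation.Binary.PropositionalEquality as ≡ using (_≡_; _≢_)

  module _ (t : ℤ) where
    private module ℚ[θ] = Q t

    pullℚ-correct : ∀ f s y → ℚ[θ].⟨ f ∣ s ℚ[θ].· y ⟩ ≡ ℚ[θ].⟨ ℚ[θ].pull f s ∣ y ⟩
    pullℚ-correct (f₀ , f₁ , f₂) (s₀ , s₁ , s₂) (y₀ , y₁ , y₂) =
      prove (fromℤ t ∷ f₀ ∷ f₁ ∷ f₂ ∷ y₀ ∷ y₁ ∷ y₂ ∷ s₀ ∷ s₁ ∷ s₂ ∷ [])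
        P.⟨ F ∣ S P.· Y ⟩ P.⟨ P.pull F S ∣ Y ⟩ ≡.refl
      where
      open ℚSolver.+-*-Solver
      module P = CubicOrder {A = Polynomial 10} _:+_ _:*_ :-_ (con 0ℚ) (con 1ℚ) (var 0F)
      F Y S : P.Triple
      F = var 1F , var 2F , var 3F
      Y = var 4F , var 5F , var 6F
      S = var 7F , var 8F , var 9F

    •-⟨∣⟩ : ∀ m f y → m ℚ.* ℚ[θ].⟨ f ∣ y ⟩ ≡ ℚ[θ].⟨ m • f ∣ y ⟩
    •-⟨∣⟩ m (f₀ , f₁ , f₂) (y₀ , y₁ , y₂) = solve 7
      (λ m f₀ f₁ f₂ y₀ y₁ y₂ → m :* (f₀ :* y₀ :+ f₁ :* y₁ :+ f₂ :* y₂) := m :* f₀ :* y₀ :+ m :* f₁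
        :* y₁ :+ m :* f₂ :* y₂)
      ≡.refl m f₀ f₁ f₂ y₀ y₁ y₂
      where open ℚSolver.+-*-Solver

    fromℤ-⟨∣⟩ : ∀ f y → fromℤ (Z.⟨_∣_⟩ t f y) ≡ ℚ[θ].⟨ fromℤ³ f ∣ fromℤ³ y ⟩
    fromℤ-⟨∣⟩ f y = cast-≡ (CastRelation.R-⟨∣⟩ t (↦-fromℤ³ t f) (↦-fromℤ³ t y))

  module SimplestCubic {c ℓ₁ ℓ₂} (t : ℤ) (-1≤t : -1ℤ ≤ t) (K : NumberField c ℓ₁ ℓ₂)
    (θ : NumberField.Carrier K)
    (θ-root : NumberField._≈_ K (evalℤ K (simplestCubic t) θ) (NumberField.0# K))
    (κ : NumberField.Carrier K → ℚ³)
    (κ-spec : ∀ x → NumberField._≈_ K x (PowerBasis.emb K t θ θ-root (κ x)))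
    (𝒪⇔ℤ[θ] : ∀ x → 𝒪 K x ⇔ ℤ[_] K θ x)
    where
    open NumberField K
    open NumberFieldLemmas K using (1≉0)
    open IsRingHomomorphism ι-isRingHomomorphism using (1#-homo; -‿homo)
    open PowerBasis K t θ θ-root

    open Coordinates κ κ-spec
    open Roots t using (σ; σ-cong; σ-⊞; σ-·; σ-neg; σ-const; trace-twisted-square≥0)

    -- Total positivity applies to ring homomorphisms only; that this map respects equality and the
    -- operations rests on the uniqueness of coordinates.
    embedding : ∀ R → IsRingHomomorphism rawRing ℝ-rawRing (λ x → σ R (κ x))
    embedding R = record
      { isSemiringHomomorphism = record
        { isNearSemiringHomomorphism = record
          { +-isMonoidHomomorphism = record
            { isMagmaHomomorphism = record
              { isRelHomomorphism = record { cong = λ x≈y → σ-cong R (κ-cong x≈y) }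
              ; homo = λ x y → ≡.subst (λ z → σ R z ≈ᵣ σ R (κ x) +ᵣ σ R (κ y)) (≡.sym (κ-+ x y))
                (σ-⊞ R (κ x) (κ y))
              }
            ; ε-homo = ≡.subst (λ z → σ R z ≈ᵣ fromℚ 0ℚ) (≡.sym (κ-unique ℚ[θ].zero (sym emb-zero)))
              (σ-const R 0ℚ)
            }
          ; *-homo = λ x y → ≡.subst (λ z → σ R z ≈ᵣ σ R (κ x) *ᵣ σ R (κ y)) (≡.sym (κ-* x y))
            (σ-· R (κ x) (κ y))
          }
        ; 1#-homo = ≡.subst (λ z → σ R z ≈ᵣ fromℚ 1ℚ)
          (≡.sym (κ-unique ℚ[θ].one (sym (trans (emb-const 1ℚ) 1#-homo)))) (σ-const R 1ℚ)
        }
      ; -‿homo = λ x → ≡.subst (λ z → σ R z ≈ᵣ -ᵣ σ R (κ x)) (≡.sym (κ-neg x)) (σ-neg R (κ x))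
      }
      where
      κ-neg : ∀ x → κ (- x) ≡ (ℚ.- 1ℚ) • κ x
      κ-neg x = ≡.trans (κ-cong (sym (trans (*-congʳ (trans (-‿homo 1ℚ) (-‿cong 1#-homo)))
        (-1*x≈-x x)))) (κ-ι* (ℚ.- 1ℚ) x)
        where open import Algebra.Properties.Ring ring using (-1*x≈-x)

    embℤ-𝒪 : ∀ z → 𝒪 K (embℤ z)
    embℤ-𝒪 z = Equivalence.from (𝒪⇔ℤ[θ] (embℤ z)) (embℤ⇒ℤ[θ] z refl)

    embℤ-unit : ∀ {u} → ℤ[θ].IsUnit u → 𝒪-unit K (embℤ u)
    embℤ-unit {u} (unit v uv≡1) = embℤ-𝒪 u , embℤ v , embℤ-𝒪 v ,
      trans (sym (embℤ-· u v)) (trans (emb-cong (≡.cong fromℤ³ uv≡1)) embℤ-one)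

    unit-nonzero : ∀ {u} → 𝒪-unit K u → 𝒪-nonzero K u
    unit-nonzero (u∈𝒪 , v , _ , uv≈1) = u∈𝒪 , λ u≈0 →
      1≉0 (trans (sym uv≈1) (trans (*-congʳ u≈0) (zeroˡ v)))

    module _ (a : Carrier) (a≫0 : TotallyPositive K a) where

      form : ℚ³
      form = ℚ[θ].pull ℚ[θ].traces (κ a)

      Tr-form : ∀ x → Tr K (a * (x * x)) ≡ ℚ[θ].⟨ form ∣ ℚ[θ].sq (κ x) ⟩
      Tr-form x = ≡.trans (Tr-κ (a * (x * x))) (≡.trans
        (≡.cong (λ y → ℚ[θ].⟨ ℚ[θ].traces ∣ y ⟩)
          (≡.trans (κ-* a (x * x)) (≡.cong (κ a ℚ[θ].·_) (κ-* x x))))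
        (pullℚ-correct t ℚ[θ].traces (κ a) (ℚ[θ].sq (κ x))))

      Tr-value : ∀ {m g} → m • form ≡ fromℤ³ g → ∀ {x} z → x ≈ embℤ z →
        m ℚ.* Tr K (a * (x * x)) ≡ fromℤ ℤ[θ].⟨ g ∣ ℤ[θ].sq z ⟩
      Tr-value {m} {g} mf≡g {x} z x≈z = begin
        m ℚ.* Tr K (a * (x * x))                             ≡⟨ ≡.cong (m ℚ.*_) (Tr-form x) ⟩
        m ℚ.* ℚ[θ].⟨ form ∣ ℚ[θ].sq (κ x) ⟩                  ≡⟨ •-⟨∣⟩ t m form (ℚ[θ].sq (κ x)) ⟩
        ℚ[θ].⟨ m • form ∣ ℚ[θ].sq (κ x) ⟩                    ≡⟨ ≡.cong₂ ℚ[θ].⟨_∣_⟩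
          mf≡g (≡.trans (≡.cong ℚ[θ].sq (κ-unique (fromℤ³ z) x≈z)) (≡.sym (fromℤ³-· t z z))) ⟩
        ℚ[θ].⟨ fromℤ³ g ∣ fromℤ³ (ℤ[θ].sq z) ⟩               ≡⟨ fromℤ-⟨∣⟩ t g (ℤ[θ].sq z) ⟨
        fromℤ ℤ[θ].⟨ g ∣ ℤ[θ].sq z ⟩                         ∎
        where open ≡.≡-Reasoning

      Tr≥0 : ∀ x → 0ℚ ℚ.≤ Tr K (a * (x * x))
      Tr≥0 x = ≡.subst (0ℚ ℚ.≤_) (≡.sym
        (≡.trans (Tr-form x) (≡.sym (pullℚ-correct t ℚ[θ].traces (κ a) (ℚ[θ].sq (κ x))))))
        (trace-twisted-square≥0 (κ a) (λ R → a≫0 _ (embedding R)) (κ x))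

      MinimumAtUnit : Set _
      MinimumAtUnit = ∃[ u ] (𝒪-unit K u × (∀ x → 𝒪-nonzero K x → Tr K (a * (u * u)) ℚ.≤ Tr K
        (a * (x * x))))

      module _ (m : ℚ) (g : ℤ³) (0<m : 0ℚ ℚ.< m) (mf≡g : m • form ≡ fromℤ³ g) where

        value : ℤ³ → ℤ
        value z = ℤ[θ].⟨ g ∣ ℤ[θ].sq z ⟩

        value≥0 : ∀ z → ℤ.0ℤ ≤ value z
        value≥0 z = fromℤ-cancel-≤ (≡.subst₂ ℚ._≤_ (ℚₚ.*-zeroʳ m) (Tr-value {m} {g} mf≡g z refl)
          (ℚₚ.*-monoˡ-≤-nonNeg m {{ℚₚ.pos⇒nonNeg m {{ℚ.positive 0<m}}}} (Tr≥0 (embℤ z))))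

        -- Both directions of `𝒪⇔ℤ[θ]` are used: a unit of the coordinate order is a unit of the
        -- ring of integers, and every competing integer has integral coordinates.
        minimum-of-value : ∀ {u} → ℤ[θ].IsUnit u → (∀ z → z ≢ ℤ[θ].zero → value u ≤ value z) →
          MinimumAtUnit
        minimum-of-value {u} u-unit u-min = embℤ u , embℤ-unit u-unit , λ x (x∈𝒪 , x≉0) →
          let (z , x≈z) = ℤ[θ]⇒embℤ (Equivalence.to (𝒪⇔ℤ[θ] x) x∈𝒪)
              z≢0 = λ z≡0 → x≉0 (trans x≈z (trans (emb-cong (≡.cong fromℤ³ z≡0)) emb-zero))
          in ℚₚ.*-cancelˡ-≤-pos m {{ℚ.positive 0<m}} (≡.subst₂ ℚ._≤_
            (≡.sym (Tr-value {m} {g} mf≡g u refl)) (≡.sym (Tr-value {m} {g} mf≡g z x≈z))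
              (fromℤ-mono-≤ (u-min z z≢0)))

        value-bound : ∀ z → value z ℤ.< + ℕ.suc ℤ.∣ value z ∣
        value-bound z = ≡.subst (ℤ._< + ℕ.suc ℤ.∣ value z ∣) (ℤₚ.0≤i⇒+∣i∣≡i (value≥0 z))
          (ℤ.+<+ (ℕₚ.n<1+n _))

        minimum-of-scaled : MinimumAtUnit
        minimum-of-scaled =
          -- The descent asks for a strict bound on the starting value, hence the successor.
          let (u , u-unit , u-min) = UnitDescent.minimal-unit t -1≤t (ℕ.suc ℤ.∣ value ℤ[θ].one ∣) g
                value≥0 (value-bound ℤ[θ].one)
          in minimum-of-value u-unit u-min

      minimum-at-unit : MinimumAtUnit
      minimum-at-unit = let (m , g , 0<m , mf≡g) = common-denominator form in minimum-of-scaled m g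
                              0<m mf≡g

    -- Units are nonzero, so a unit that is minimal among all nonzero integers attains both minima.
    unit-reducible : UnitReducible K
    unit-reducible a a≫0 = let (u , u-unit , u-min) = minimum-at-unit a a≫0 in
      Tr K (a * (u * u)) ,
      ((u , unit-nonzero u-unit , ≡.refl) , u-min) ,
      ((u , u-unit , ≡.refl) , λ x x-unit → u-min x (unit-nonzero x-unit))

open import Data.Integer.Base using (ℤ; -1ℤ; _≤_)
open import Data.Product.Base using (proj₁; proj₂)
open import Function.Bundles using (_⇔_)

theorem5 : ∀ {c ℓ₁ ℓ₂} (t : ℤ) → -1ℤ ≤ t →
    (K : NumberField c ℓ₁ ℓ₂) → let open NumberField K in
    (θ : Carrier) → evalℤ K (simplestCubic t) θ ≈ 0# →
    (∀ x → ℚ⟨_⟩ K θ x) →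
    (∀ x → 𝒪 K x ⇔ ℤ[_] K θ x) →
    UnitReducible K
theorem5 t -1≤t K θ θ-root generates = Conclusion.SimplestCubic.unit-reducible t -1≤t K θ θ-root
  (λ x → proj₁ (coordinates x)) (λ x → proj₂ (coordinates x))
  where
  coordinates = PowerBases.PowerBasis.coordinates K t θ θ-root generates
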